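{- Let $(\mathcal{X},d)$ be a finite metric space with implicit metric graph $G_\mathcal{X}$, let $\mathcal{P} = \{P_1,\dots,P_t\}$ be a partition of $\mathcal{X}$ with spanning trees $T_1,\dots,T_t$ of its components, and suppose that this initial forest has finite $\gamma$-overlap $\gamma = \gamma(\mathcal{P})$. Then the algorithm MFC-Approx on this input returns a spanning tree $\hat{T}$ of $G_\mathcal{X}$ that satisfies $$w_\mathcal{X}(T_\mathcal{X}) \leq w_\mathcal{X}(\hat{T}) \leq \beta\, w_\mathcal{X}(T_\mathcal{X}),$$ where $T_\mathcal{X}$ is a minimum spanning tree of $G_\mathcal{X}$ and $$\beta = \tfrac{1}{2}\left(2\gamma + 1 + \sqrt{4\gamma+1}\right) \leq 2\gamma + 1.$$
   Context: Setting. $(\mathcal{X},d)$ is a finite metric space. The complete graph $G_\mathcal{X}$ has node set $\mathcal{X}$, all pairs of points as edges, and edge weights $w_\mathcal{X}(x,y) = d(x,y)$. For a set $F$ of edges (or a graph with edge set $F$), $w_\mathcal{X}(F) = \sum_{e\in F} w_\mathcal{X}(e)$. Initial forest. $\mathcal{P} = \{P_1,\dots,P_t\}$ is a partition of $\mathcal{X}$ into disjoint nonempty components and, for each $i$, $T_i = (P_i,E_{T_i})$ is a spanning tree of $P_i$ (an arbitrary tree on the node set $P_i$, not necessarily of minimum weight). Let $E_t = \bigcup_{i=1}^t E_{T_i}$. $\gamma$-overlap. Let $\mathcal{T}_\mathcal{X}$ be the set of minimum spanning trees of $G_\mathcal{X}$. For $T\in\mathcal{T}_\mathcal{X}$ let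 $T(\mathcal{P})$ be the set of edges of $T$ having both endpoints in the same component of $\mathcal{P}$. The $\gamma$-overlap of the initial forest is $$\gamma(\mathcal{P}) = \frac{w_\mathcal{X}(E_t)}{\max_{T\in\mathcal{T}_\mathcal{X}} w_\mathcal{X}(T(\mathcal{P}))}.$$ Finite means that the denominator is nonzero. One always has $\gamma(\mathcal{P}) \geq 1$. Algorithm MFC-Approx. (1) For each $i$, choose an arbitrary representative $s_i \in P_i$. (2) For each pair $i\neq j$, compute $w_{i\to j} = \min_{x\in P_i} d(x,s_j)$, $w_{j\to i} = \min_{x\in P_j} d(x,s_i)$, and $\hat{w}_{ij} = \min\{w_{i\to j}, w_{j\to i}\}$, recording a pair of points (one in $P_i$, one in $P_j$) at distance $\hat{w}_{ij}$ that attains this minimum. (3) Compute a minimum spanning tree $\hat{T}_\mathcal{P}$ of the complete graph on nodes $v_1,\dots,v_t$ with edge weights $\hat{w}_{ij}$. (4) Let $\hat{M}$ be the set of recorded point pairs corresponding to the edges of $\hat{T}_\mathcal{P}$, and return $\hat{T} = (\mathcal{X}, E_t\cup \hat{M})$. All choices and ties are arbitrary. -}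

module Defs where

open import Algebra.Bundles using (CommutativeRing)
open import Algebra.Core using (Op₁; Op₂)
open import Algebra.Structures using (IsCommutativeRing)
import Algebra.Construct.NaturalChoice.Min as Min
import Algebra.Properties.Monoid.Sum as Sum
open import Data.Bool.Base using (if_then_else_; _∧_)
open import Data.Fin.Base using (Fin)
open import Data.Fin.Properties using (_≟_; _<?_; any?)
open import Data.List.Base using (List; _∷_; _∷ʳ_)
open import Data.List.Relation.Unary.Linked using (Linked)
open import Data.List.Relation.Unary.Unique.Propositional using (Unique)
open import Data.Nat.Base using (ℕ)
open import Data.Product.Base using (∃-syntax; _×_; _,_)
open import Data.Sum.Base using (_⊎_; inj₁; inj₂; map)
open import Function.Base using (_∘_)
open import Function.Definitions using (StrictlySurjective)
open import Function.Metric.Structures using (IsGeneralMetric)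
open import Level using (Level; _⊔_; suc; 0ℓ)
open import Relation.Binary.Bundles using (TotalOrder)
open import Relation.Binary.Construct.Closure.ReflexiveTransitive using (Star)
open import Relation.Binary.Core using (Rel)
open import Relation.Binary.Definitions using (Decidable; Symmetric; Irreflexive)
open import Relation.Binary.PropositionalEquality.Core
  using (_≡_; _≢_; refl; sym; trans; cong)
open import Relation.Binary.Structures using (IsDecTotalOrder)
open import Relation.Nullary using (¬_; does)
open import Relation.Nullary.Decidable using (_×-dec_; _⊎-dec_)
open import Relation.Unary using (Pred; U)

private variable
  a p : Level
  n t : ℕ

-- The scalars: a totally ordered field in which nonnegative elements have
-- square roots. The real numbers are the intended instance. Inverse and square
-- root are total functions whose values are unspecified outside the domain
-- given by their law.

record EuclideanField c ℓ₁ ℓ₂ : Set (suc (c ⊔ ℓ₁ ⊔ ℓ₂)) where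
  infix  4 _≈_ _≤_ _≉_
  infixl 6 _+_
  infixl 7 _*_ _/_
  infix  8 -_ _⁻¹
  field
    Carrier           : Set c
    _≈_               : Rel Carrier ℓ₁
    _≤_               : Rel Carrier ℓ₂
    _+_ _*_           : Op₂ Carrier
    -_ _⁻¹ √_         : Op₁ Carrier
    0# 1#             : Carrier
    isCommutativeRing : IsCommutativeRing _≈_ _+_ _*_ -_ 0# 1#
    isDecTotalOrder   : IsDecTotalOrder _≈_ _≤_
    0≉1               : ¬ (0# ≈ 1#)
    ⁻¹-inverseʳ       : ∀ x → ¬ (x ≈ 0#) → x * x ⁻¹ ≈ 1#
    +-monoˡ-≤         : ∀ z {x y} → x ≤ y → x + z ≤ y + z
    *-nonNegative     : ∀ {x y} → 0# ≤ x → 0# ≤ y → 0# ≤ x * y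
    √-nonNegative     : ∀ {x} → 0# ≤ x → 0# ≤ √ x
    √-square          : ∀ {x} → 0# ≤ x → √ x * √ x ≈ x

  _≉_ : Rel Carrier ℓ₁
  x ≉ y = ¬ (x ≈ y)

  _/_ : Op₂ Carrier
  x / y = x * y ⁻¹

  2# 4# : Carrier
  2# = 1# + 1#
  4# = 2# + 2#

  commutativeRing : CommutativeRing c ℓ₁
  commutativeRing = record { isCommutativeRing = isCommutativeRing }

  totalOrder : TotalOrder c ℓ₁ ℓ₂
  totalOrder = record { isTotalOrder = IsDecTotalOrder.isTotalOrder isDecTotalOrder }

  open CommutativeRing commutativeRing public using (+-monoid)
  open Sum +-monoid public using (sum)
  open Min totalOrder public using (_⊓_)

-- Finite simple graphs on the vertices Fin n, identified with their edge sets.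

record Graph (n : ℕ) : Set₁ where
  field
    Adj    : Rel (Fin n) 0ℓ
    adj?   : Decidable Adj
    symm   : Symmetric Adj
    irrefl : Irreflexive _≡_ Adj

open Graph

infixr 6 _∪_

_∪_ : Graph n → Graph n → Graph n
G ∪ H = record
  { Adj    = λ x y → Adj G x y ⊎ Adj H x y
  ; adj?   = λ x y → adj? G x y ⊎-dec adj? H x y
  ; symm   = map (symm G) (symm H)
  ; irrefl = λ { x≡y (inj₁ e) → irrefl G x≡y e ; x≡y (inj₂ e) → irrefl H x≡y e }
  }

⋃ : (Fin t → Graph n) → Graph n
⋃ G = record
  { Adj    = λ x y → ∃[ i ] Adj (G i) x y
  ; adj?   = λ x y → any? λ i → adj? (G i) x y
  ; symm   = λ { (i , e) → i , symm (G i) e }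
  ; irrefl = λ { x≡y (i , e) → irrefl (G i) x≡y e }
  }

-- The list x ∷ y ∷ z ∷ vs runs once around the cycle, so there are at least
-- three distinct vertices.

record Cycle (G : Graph n) : Set where
  field
    x y z    : Fin n
    vs       : List (Fin n)
    distinct : Unique (x ∷ y ∷ z ∷ vs)
    closed   : Linked (Adj G) ((x ∷ y ∷ z ∷ vs) ∷ʳ x)

-- G, regarded as a graph with node set S, is a tree.

record IsTreeOn (S : Pred (Fin n) 0ℓ) (G : Graph n) : Set where
  field
    within    : ∀ {x y} → Adj G x y → S x × S y
    connected : ∀ {x y} → S x → S y → Star (Adj G) x y
    acyclic   : ¬ Cycle G

IsSpanningTree : Graph n → Set
IsSpanningTree = IsTreeOn U

-- A partition of Fin n into t nonempty components, given by the map sending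
-- each point to the index of its component, with a tree on each component.

record InitialForest (n t : ℕ) : Set₁ where
  field
    component  : Fin n → Fin t
    nonempty   : StrictlySurjective _≡_ component
    tree       : Fin t → Graph n
    isTree     : ∀ i → IsTreeOn (λ x → component x ≡ i) (tree i)

  forest : Graph n
  forest = ⋃ tree

  -- The edges of T with both endpoints in the same component.
  inner : Graph n → Graph n
  inner T = record
    { Adj    = λ x y → Adj T x y × component x ≡ component y
    ; adj?   = λ x y → adj? T x y ×-dec (component x ≟ component y)
    ; symm   = λ { (e , eq) → symm T e , sym eq }
    ; irrefl = λ { x≡y (e , _) → irrefl T x≡y e }
    }

module Approximation {c ℓ₁ ℓ₂} (K : EuclideanField c ℓ₁ ℓ₂) where

  open EuclideanField K

  IsMinimum IsMaximum : {A : Set a} → Pred A p → (A → Carrier) → Carrier → Set _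
  IsMinimum P f v = (∃[ x ] P x × f x ≈ v) × (∀ x → P x → v ≤ f x)
  IsMaximum P f v = (∃[ x ] P x × f x ≈ v) × (∀ x → P x → f x ≤ v)

  -- Each unordered edge is counted once, at its increasing orientation.
  weight : (Fin n → Fin n → Carrier) → Graph n → Carrier
  weight w G = sum λ x → sum λ y →
    if does (x <? y) ∧ does (adj? G x y) then w x y else 0#

  -- Minimum spanning trees of the complete graph on Fin n with edge weights w.
  IsMST : (Fin n → Fin n → Carrier) → Graph n → Set _
  IsMST w T = IsSpanningTree T × (∀ T′ → IsSpanningTree T′ → weight w T ≤ weight w T′)

  record FiniteMetricSpace (n : ℕ) : Set (c ⊔ ℓ₁ ⊔ ℓ₂) where
    field
      d        : Fin n → Fin n → Carrier
      isMetric : IsGeneralMetric _≡_ _≈_ _≤_ 0# _+_ d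

  module _ (X : FiniteMetricSpace n) (F : InitialForest n t) where

    open FiniteMetricSpace X
    open InitialForest F

    -- γ is the overlap of the initial forest, which in particular is finite.
    HasOverlap : Carrier → Set _
    HasOverlap γ = ∃[ m ] IsMaximum (IsMST d) (weight d ∘ inner) m
                        × m ≉ 0#
                        × γ ≈ weight d forest / m

    -- A run of the algorithm: one admissible way of making all of its choices.
    record Run : Set (suc 0ℓ ⊔ c ⊔ ℓ₁ ⊔ ℓ₂) where
      field
        rep   : Fin t → Fin n
        rep-∈ : ∀ i → component (rep i) ≡ i

        -- toRep i j is the distance from component i to the representative of
        -- component j; its values on the diagonal are irrelevant.
        toRep     : Fin t → Fin t → Carrier
        toRep-min : ∀ {i j} → i ≢ j →
          IsMinimum (λ x → component x ≡ i) (λ x → d x (rep j)) (toRep i j)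

      ŵ : Fin t → Fin t → Carrier
      ŵ i j = toRep i j ⊓ toRep j i

      -- For i ≢ j the pair recorded for {i , j} consists of link i j, in
      -- component i, and link j i, in component j. It comes from one of the two
      -- minimisations above, hence one of its points is a representative.
      field
        link        : Fin t → Fin t → Fin n
        link-∈      : ∀ {i j} → i ≢ j → component (link i j) ≡ i
        link-rep    : ∀ {i j} → i ≢ j → link i j ≡ rep i ⊎ link j i ≡ rep j
        link-attain : ∀ {i j} → i ≢ j → d (link i j) (link j i) ≈ ŵ i j

        coarseTree : Graph t
        coarse-MST : IsMST ŵ coarseTree

      completion : Graph n
      completion = record
        { Adj    = λ x y → ∃[ i ] ∃[ j ] Adj coarseTree i j × x ≡ link i j × y ≡ link j i
        ; adj?   = λ x y → any? λ i → any? λ j →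
            adj? coarseTree i j ×-dec (x ≟ link i j) ×-dec (y ≟ link j i)
        ; symm   = λ { (i , j , e , p , q) → j , i , symm coarseTree e , q , p }
        ; irrefl = λ { x≡y (i , j , e , p , q) →
            let i≢j = λ i≡j → irrefl coarseTree i≡j e in
            i≢j (trans (sym (link-∈ i≢j))
                (trans (cong component (trans (sym p) (trans x≡y q)))
                       (link-∈ (i≢j ∘ sym)))) }
        }

      output : Graph n
      output = forest ∪ completion

  β : Carrier → Carrier
  β γ = 1# / 2# * (2# * γ + 1# + √ (4# * γ + 1#))

{-
The coarse tree computed by the algorithm is compared with two other spanning
trees on the components, both obtained from a minimum spanning tree T of the
points. Write W for the weight of the initial forest, m = W / γ for the weight
of the edges of T inside the components, τ for the weight of T, and M for the
weight of the coarse tree.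

Growing a rooted tree on the components along edges of T, the link into the
component of a child v costs at most the crossing edge x y of T plus the
distance from y to the representative of v, which the initial tree on v pays
for. Hence M ≤ (τ - m) + W. Going around T visits all representatives within
length 2τ, hence M ≤ 2τ. The output weighs at most W + M, and m ≤ τ. If γ ≤ 2
then √(4γ + 1) ≥ 2γ - 1, and the first bound gives W + M ≤ βτ; if γ ≥ 2 then
√(4γ + 1) ≥ 3, and the second one gives W + M ≤ (γ + 2)τ ≤ βτ.
-}
module Submission where

open import Defs
open import Data.Nat.Base using (ℕ)
open import Data.Product.Base using (_×_)

open import Algebra.Bundles using (CommutativeRing)
import Algebra.Construct.NaturalChoice.Min
import Algebra.Properties.Monoid.Sum
import Algebra.Solver.Ring.NaturalCoefficients.Default
open import Data.Bool.Base using (if_then_else_; _∧_)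
open import Data.Empty using (⊥-elim)
open import Data.Fin.Base as Fin using (Fin; zero; suc)
open import Data.Fin.Properties using (_≟_; _<?_; all?; injective⇒≤)
import Data.Fin.Properties as Fin
open import Data.List.Base
  using (List; []; _∷_; _∷ʳ_; _++_; length; lookup; map; filter; allFin; cartesianProduct; cartesianProductWith)
import Data.List.Extrema
open import Data.List.Membership.DecPropositional using () renaming (_∈?_ to decMember)
open import Data.List.Membership.Propositional using (_∈_; _∉_)
open import Data.List.Membership.Propositional.Properties
  using (∈-allFin; ∈-filter⁺; ∈-cartesianProduct⁺; ∈-cartesianProductWith⁺; ∈-lookup)
open import Data.List.Relation.Unary.All as All using (All; []; _∷_)
open import Data.List.Relation.Unary.All.Properties as All using (¬Any⇒All¬; all-filter)
open import Data.List.Relation.Unary.AllPairs as AllPairs using (AllPairs; []; _∷_)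
import Data.List.Relation.Unary.AllPairs.Properties as AllPairs
open import Data.List.Relation.Unary.Any as Any using (Any; here; there)
import Data.List.Relation.Unary.Any.Properties as Any
open import Data.List.Relation.Unary.Linked using (Linked; [-]; _∷_)
open import Data.List.Relation.Unary.Unique.Propositional using (Unique)
import Data.List.Relation.Unary.Unique.Propositional.Properties as Unique
import Data.Nat.Base as ℕ
import Data.Nat.Properties as ℕ
open import Data.Product.Base using (∃-syntax; _,_; proj₁; proj₂; uncurry)
open import Data.Sum.Base as Sum using (_⊎_; inj₁; inj₂)
open import Data.Unit.Base using (⊤; tt)
open import Function.Base using (_∘_; case_of_)
open import Function.Bundles using (mk⇔)
open import Function.Metric.Structures using (IsGeneralMetric)
open import Level using (0ℓ)
open import Relation.Binary.Construct.Closure.ReflexiveTransitive as Star using (Star; ε; _◅_; _◅◅_)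
open import Relation.Binary.Bundles using (TotalOrder)
open import Relation.Binary.Core using (Rel; _⇒_)
open import Relation.Binary.Definitions using (Decidable; Symmetric; tri<; tri≈; tri>)
open import Relation.Binary.PropositionalEquality
  using (_≡_; _≢_; refl; cong; subst; subst₂) renaming (sym to ≡-sym; trans to ≡-trans)
open import Relation.Binary.Structures using (IsDecTotalOrder)
open import Relation.Nullary using (¬_; Dec; yes; no; does)
open import Relation.Nullary.Decidable using (_×-dec_; ¬?; map′; dec-true; dec-false; does-⇔)

open Graph

private variable
  n t : ℕ

-- Graphs, bridges and rooted trees

Edge : ℕ → Set
Edge n = Fin n × Fin n

-- Equality of undirected edges. The pairs themselves stay oriented because rooted trees distinguish
-- parent from child.
data Same {n} : Rel (Edge n) 0ℓ where
  straight : ∀ {x y} → Same (x , y) (x , y)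
  crossed  : ∀ {x y} → Same (x , y) (y , x)

same? : Decidable (Same {n})
same? (a , b) (x , y) with a ≟ x | b ≟ y | a ≟ y | b ≟ x
... | yes refl | yes refl | _        | _        = yes straight
... | _        | _        | yes refl | yes refl = yes crossed
... | no a≢x   | _        | no a≢y   | _        = no λ { straight → a≢x refl ; crossed → a≢y refl }
... | no a≢x   | _        | _        | no b≢x   = no λ { straight → a≢x refl ; crossed → b≢x refl }
... | _        | no b≢y   | no a≢y   | _        = no λ { straight → b≢y refl ; crossed → a≢y refl }
... | _        | no b≢y   | _        | no b≢x   = no λ { straight → b≢y refl ; crossed → b≢x refl }

same-sym : Symmetric (Same {n})
same-sym straight = straight
same-sym crossed  = crossed

same-swap : ∀ {x y} {e : Edge n} → Same (x , y) e → Same (y , x) e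
same-swap straight = crossed
same-swap crossed  = straight

-- Graph weights count only increasing pairs, so this confines the effect of removing an edge to a
-- single term.
same-ordered : ∀ {u v x y} {e : Edge n} → u Fin.< v → x Fin.< y →
               Same (u , v) e → Same (x , y) e → (u , v) ≡ (x , y)
same-ordered u<v x<y straight straight = refl
same-ordered u<v x<y straight crossed  = ⊥-elim (Fin.<-asym u<v x<y)
same-ordered u<v x<y crossed  straight = ⊥-elim (Fin.<-asym u<v x<y)
same-ordered u<v x<y crossed  crossed  = refl

Distinct : Rel (Edge n) 0ℓ
Distinct e f = ¬ Same e f

infixl 6 _∖_

_∖_ : Graph n → Edge n → Graph n
G ∖ e = record
  { Adj    = λ x y → Adj G x y × ¬ Same (x , y) e
  ; adj?   = λ x y → adj? G x y ×-dec ¬? (same? (x , y) e)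
  ; symm   = λ { (a , ¬s) → symm G a , ¬s ∘ same-swap }
  ; irrefl = λ { eq (a , _) → irrefl G eq a }
  }

-- An edgewise form of acyclicity. Walks, unlike cycles, can be pushed along maps that identify
-- vertices, so acyclicity is proved in this form below.
Bridges : Graph n → Set
Bridges G = ∀ {x y} → Adj G x y → ¬ Star (Adj (G ∖ (x , y))) y x

module _ {G : Graph n} where

  -- Each edge of this last stretch of the cycle starts at a vertex other than `x` and `y`, so it is
  -- not the removed edge.
  return : ∀ {x y} z vs → x ≢ z → y ≢ z → All (x ≢_) vs → All (y ≢_) vs →
           Linked (Adj G) (z ∷ (vs ∷ʳ x)) → Star (Adj (G ∖ (x , y))) z x
  return z []       x≢z y≢z _ _ (e ∷ [-]) =
    (e , λ { straight → x≢z refl ; crossed → y≢z refl }) ◅ ε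
  return z (v ∷ vs) x≢z y≢z (x≢v ∷ x∉vs) (y≢v ∷ y∉vs) (e ∷ es) =
    (e , λ { straight → x≢z refl ; crossed → y≢z refl }) ◅ return v vs x≢v y≢v x∉vs y∉vs es

  -- The rest of a cycle is a detour around its first edge.
  bridges⇒acyclic : Bridges G → ¬ Cycle G
  bridges⇒acyclic bridges record
    { z = z ; vs = vs
    ; distinct = (x≢y ∷ x≢z ∷ x∉vs) ∷ (y≢z ∷ y∉vs) ∷ _
    ; closed = xy ∷ yz ∷ zx
    } = bridges xy
      ((yz , λ { straight → x≢y refl ; crossed → x≢z refl }) ◅ return z vs x≢z y≢z x∉vs y∉vs zx)

-- The index lists the vertices after the first one.
data Path {A : Set} (R : Rel A 0ℓ) : A → A → List A → Set where
  []  : ∀ {x} → Path R x x []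
  _∷_ : ∀ {x y z ws} → R x y → Path R y z ws → Path R x z (y ∷ ws)

module _ {R : Rel (Fin n) 0ℓ} where

  suffix : ∀ {v x z ws} → v ∈ x ∷ ws → Path R x z ws → Unique (x ∷ ws) →
           ∃[ us ] Path R v z us × Unique (v ∷ us)
  suffix (here refl) p       u       = _ , p , u
  suffix (there v∈)  (_ ∷ p) (_ ∷ u) = suffix v∈ p u

  -- Loop erasure: if the tail returns to the starting point, only what follows that return is kept.
  simplePath : ∀ {x z} → Star R x z → ∃[ ws ] Path R x z ws × Unique (x ∷ ws)
  simplePath ε = [] , [] , [] ∷ []
  simplePath {x} (_◅_ {j = y} e s) =
    let ws , p , u = simplePath s in case decMember _≟_ x (y ∷ ws) of λ where
      (yes x∈) → suffix x∈ p u
      (no x∉)  → y ∷ ws , e ∷ p , ¬Any⇒All¬ _ x∉ ∷ u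

closePath : ∀ {R Q : Rel (Fin n) 0ℓ} {x y z ws} → R ⇒ Q →
            Path R x y ws → Q y z → Linked Q ((x ∷ ws) ∷ʳ z)
closePath f []          q = q ∷ [-]
closePath f (r ∷ [])    q = f r ∷ q ∷ [-]
closePath f (r ∷ s ∷ p) q = f r ∷ closePath f (s ∷ p) q

-- Make the detour simple. With no edge it would turn `x y` into a loop, with one edge it would be
-- the removed edge itself, and with more it closes up with `x y` to a cycle.
acyclic⇒bridges : ∀ {G : Graph n} → ¬ Cycle G → Bridges G
acyclic⇒bridges {G = G} acyclic xy s with simplePath s
... | _ , []             , _ = irrefl G refl xy
... | _ , (_ , ¬s) ∷ []  , _ = ¬s crossed
... | _ , p@(_ ∷ _ ∷ _)  , u = acyclic record { distinct = u ; closed = closePath proj₁ p xy }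

-- Rooted trees grown edge by edge

edgeGraph : List (Edge n) → Graph n
edgeGraph es = record
  { Adj    = λ x y → x ≢ y × Any (Same (x , y)) es
  ; adj?   = λ x y → ¬? (x ≟ y) ×-dec Any.any? (same? (x , y)) es
  ; symm   = λ { (x≢y , s) → x≢y ∘ ≡-sym , Any.map same-swap s }
  ; irrefl = λ { eq (x≢y , _) → x≢y eq }
  }

vertices : Fin n → List (Edge n) → List (Fin n)
vertices r []             = r ∷ []
vertices r ((_ , v) ∷ es) = v ∷ vertices r es

-- A rooted tree, as the list of its edges (parent , child) in an order in which
-- every edge is preceded (in the tail of the list) by the one to its parent.
data Grown (r : Fin n) : List (Edge n) → Set where
  []   : Grown r []
  grow : ∀ {p v es} → p ∈ vertices r es → v ∉ vertices r es → Grown r es → Grown r ((p , v) ∷ es)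

root∈ : ∀ (r : Fin n) es → r ∈ vertices r es
root∈ r []       = here refl
root∈ r (_ ∷ es) = there (root∈ r es)

grown? : ∀ (r : Fin n) es → Dec (Grown r es)
grown? r []             = yes []
grown? r ((p , v) ∷ es) =
  map′ (λ { (p∈ , v∉ , g) → grow p∈ v∉ g }) (λ { (grow p∈ v∉ g) → p∈ , v∉ , g })
    (decMember _≟_ p (vertices r es) ×-dec ¬? (decMember _≟_ v (vertices r es)) ×-dec grown? r es)

lookup-injective : ∀ {A : Set} {xs : List A} → Unique xs → ∀ i j → lookup xs i ≡ lookup xs j → i ≡ j
lookup-injective (_ ∷ _)  zero    zero    _  = refl
lookup-injective (x∉ ∷ _) zero    (suc j) eq = ⊥-elim (All.lookup x∉ (∈-lookup j) eq)
lookup-injective (x∉ ∷ _) (suc i) zero    eq = ⊥-elim (All.lookup x∉ (∈-lookup i) (≡-sym eq))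
lookup-injective (_ ∷ u)  (suc i) (suc j) eq = cong suc (lookup-injective u i j eq)

length-vertices : ∀ (r : Fin n) es → length (vertices r es) ≡ ℕ.suc (length es)
length-vertices r []       = refl
length-vertices r (_ ∷ es) = cong ℕ.suc (length-vertices r es)

module _ {r : Fin n} where

  endpoints∈ : ∀ {es x y} → Grown r es → Any (Same (x , y)) es → x ∈ vertices r es × y ∈ vertices r es
  endpoints∈ (grow p∈ _ _) (here straight) = there p∈ , here refl
  endpoints∈ (grow p∈ _ _) (here crossed)  = here refl , there p∈
  endpoints∈ (grow _ _ g)  (there s)       = let x∈ , y∈ = endpoints∈ g s in there x∈ , there y∈

  grown-irreflexive : ∀ {es} → Grown r es → All (uncurry _≢_) es
  grown-irreflexive []             = []
  grown-irreflexive (grow p∈ v∉ g) = (λ { refl → v∉ p∈ }) ∷ grown-irreflexive g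

  -- The child of each edge is new, so no edge in the tail touches it.
  grown-distinct : ∀ {es} → Grown r es → AllPairs Distinct es
  grown-distinct []             = []
  grown-distinct (grow _ v∉ g) = ¬Any⇒All¬ _ (v∉ ∘ proj₂ ∘ endpoints∈ g) ∷ grown-distinct g

  grown-unique : ∀ {es} → Grown r es → Unique (vertices r es)
  grown-unique []             = [] ∷ []
  grown-unique (grow _ v∉ g) = ¬Any⇒All¬ _ v∉ ∷ grown-unique g

  -- Pigeonhole: the vertices are distinct, and there is one more of them than edges. The bound
  -- makes the search for a minimum spanning tree finite.
  grown-length : ∀ {es} → Grown r es → length es ℕ.< n
  grown-length {es} g = subst (ℕ._≤ _) (length-vertices r es)
    (injective⇒≤ (lookup-injective (grown-unique g) _ _))

  grown-connected : ∀ {es} → Grown r es → ∀ {x} → x ∈ vertices r es → Star (Adj (edgeGraph es)) r x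
  grown-connected []                        (here refl) = ε
  grown-connected (grow {p} {v} {es} p∈ v∉ g) x∈          = extend x∈
    where
    lift : Adj (edgeGraph es) ⇒ Adj (edgeGraph ((p , v) ∷ es))
    lift (x≢y , s) = x≢y , there s

    extend : ∀ {x} → x ∈ v ∷ vertices r es → Star (Adj (edgeGraph ((p , v) ∷ es))) r x
    extend (here refl) = Star.map lift (grown-connected g p∈)
                         ◅◅ ((λ { refl → v∉ p∈ }) , here straight) ◅ ε
    extend (there x∈′) = Star.map lift (grown-connected g x∈′)

  -- The newest vertex is a leaf: it is isolated once its edge is removed, and
  -- retracting it onto its parent sends detours to detours in the older tree.
  grown-bridges : ∀ {es} → Grown r es → Bridges (edgeGraph es)
  grown-bridges (grow {p} {v} {es} p∈ v∉ g) {x} {y} (x≢y , s) detour = impossible s detour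
    where
    T′ : Graph n
    T′ = edgeGraph ((p , v) ∷ es)

    isolated : ∀ {e z} → Same (p , v) e → ¬ Adj (T′ ∖ e) v z
    isolated straight ((_ , here straight) , ¬s) = ¬s straight
    isolated straight ((_ , here crossed)  , ¬s) = ¬s crossed
    isolated crossed  ((_ , here straight) , ¬s) = ¬s crossed
    isolated crossed  ((_ , here crossed)  , ¬s) = ¬s straight
    isolated _        ((_ , there s)       , _)  = v∉ (proj₁ (endpoints∈ g s))

    retract : Fin n → Fin n
    retract z with z ≟ v
    ... | yes _ = p
    ... | no  _ = z

    retract-fix : ∀ {z} → z ≢ v → retract z ≡ z
    retract-fix {z} z≢v with z ≟ v
    ... | yes z≡v = ⊥-elim (z≢v z≡v)
    ... | no  _   = refl

    retract-leaf : retract v ≡ p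
    retract-leaf with v ≟ v
    ... | yes _  = refl
    ... | no v≢v = ⊥-elim (v≢v refl)

    old : ∀ {z} → z ∈ vertices r es → z ≢ v
    old z∈ refl = v∉ z∈

    step : ∀ {e a b} → Adj (T′ ∖ e) a b → Star (Adj (edgeGraph es ∖ e)) (retract a) (retract b)
    step ((_ , here straight) , _) rewrite retract-leaf | retract-fix (old p∈) = ε
    step ((_ , here crossed)  , _) rewrite retract-leaf | retract-fix (old p∈) = ε
    step ((a≢b , there s) , ¬s)
      rewrite retract-fix (old (proj₁ (endpoints∈ g s))) | retract-fix (old (proj₂ (endpoints∈ g s))) =
      ((a≢b , s) , ¬s) ◅ ε

    impossible : Any (Same (x , y)) ((p , v) ∷ es) → ¬ Star (Adj (T′ ∖ (x , y))) y x
    impossible (here straight) ε       = x≢y refl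
    impossible (here straight) (a ◅ _) = isolated straight a
    -- Here the detour ends at the leaf, so it is reversed to start there.
    impossible (here crossed)  s′      with Star.reverse (symm (T′ ∖ (v , p))) s′
    ... | ε     = x≢y refl
    ... | a ◅ _ = isolated crossed a
    impossible (there s) s′ = grown-bridges g (x≢y , s)
      (subst₂ (Star (Adj (edgeGraph es ∖ (x , y))))
        (retract-fix (old (proj₂ (endpoints∈ g s)))) (retract-fix (old (proj₁ (endpoints∈ g s))))
        (Star.kleisliStar retract step s′))

  grown-spanning : ∀ {es} → Grown r es → (∀ x → x ∈ vertices r es) → IsSpanningTree (edgeGraph es)
  grown-spanning {es} g spans = record
    { within    = λ _ → tt , tt
    ; connected = λ {x} {y} _ _ →
        Star.reverse (symm (edgeGraph es)) (grown-connected g (spans x)) ◅◅ grown-connected g (spans y)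
    ; acyclic   = bridges⇒acyclic (grown-bridges g)
    }

  module _ {R : Rel (Fin n) 0ℓ} where

    -- Follows the walk and adds an edge whenever it enters a vertex outside the tree. `R` is
    -- abstract because it will be a spanning tree, an initial tree, the contracted tree `Quotient`
    -- and the full relation in turn.
    growTo : ∀ {es x u} → Grown r es → All (uncurry R) es → x ∈ vertices r es → Star R x u →
             ∃[ es′ ] Grown r es′ × All (uncurry R) es′
                      × (∀ {v} → v ∈ vertices r es → v ∈ vertices r es′) × u ∈ vertices r es′
    growTo {es} g rs x∈ ε = es , g , rs , (λ v∈ → v∈) , x∈
    growTo {es} g rs x∈ (_◅_ {j = y} xy s) with decMember _≟_ y (vertices r es)
    ... | yes y∈ = growTo g rs y∈ s
    ... | no y∉  = let es′ , g′ , rs′ , ⊆′ , u∈ = growTo (grow x∈ y∉ g) (xy ∷ rs) (here refl) s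
                   in es′ , g′ , rs′ , ⊆′ ∘ there , u∈

    growAll : (∀ u → Star R r u) →
              ∃[ es ] Grown r es × All (uncurry R) es × (∀ u → u ∈ vertices r es)
    growAll reach = let es , g , rs , us∈ = go (allFin n) in es , g , rs , λ u → All.lookup us∈ (∈-allFin u)
      where
      go : ∀ us → ∃[ es ] Grown r es × All (uncurry R) es × All (_∈ vertices r es) us
      go []       = [] , [] , [] , []
      go (u ∷ us) =
        let es  , g  , rs  , us∈    = go us
            es′ , g′ , rs′ , ⊆ , u∈ = growTo g rs (root∈ r es) (reach u)
        in es′ , g′ , rs′ , u∈ ∷ All.map ⊆ us∈

-- Enumeration of the edge lists of bounded length

edgeLists : ℕ → List (List (Edge n))
edgeLists     ℕ.zero    = [] ∷ []
edgeLists {n} (ℕ.suc k) = [] ∷ cartesianProductWith _∷_ (cartesianProduct (allFin n) (allFin n)) (edgeLists k)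

∈-edgeLists : ∀ {k} {es : List (Edge n)} → length es ℕ.≤ k → es ∈ edgeLists k
∈-edgeLists {k = ℕ.zero}  {[]}     _            = here refl
∈-edgeLists {k = ℕ.suc _} {[]}     _            = here refl
∈-edgeLists {k = ℕ.suc _} {_ ∷ _}  (ℕ.s≤s len≤) = there
  (∈-cartesianProductWith⁺ _∷_ (∈-cartesianProduct⁺ (∈-allFin _) (∈-allFin _)) (∈-edgeLists len≤))

-- Ordered field arithmetic and the constant β

module _ {κ ℓ₁ ℓ₂} (K : EuclideanField κ ℓ₁ ℓ₂) where

  open EuclideanField K
  open Approximation K
  open CommutativeRing commutativeRing
    using ( commutativeSemiring; +-identityˡ; +-identityʳ; *-identityˡ; *-identityʳ; +-cong; +-congˡ; +-congʳ
          ; *-cong; *-congˡ; *-congʳ; +-assoc; +-comm; *-assoc; *-comm; -‿inverseˡ; -‿inverseʳ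
          ; distribˡ; distribʳ; zeroˡ; zeroʳ)
    renaming (refl to ≈-refl; reflexive to ≈-reflexive; sym to ≈-sym; trans to ≈-trans)
  open IsDecTotalOrder isDecTotalOrder
    using (total; antisym)
    renaming (_≟_ to _≈?_; refl to ≤-refl; reflexive to ≤-reflexive; trans to ≤-trans)
  -- The numerals of the solver do not evaluate to 1#, which is therefore passed
  -- to it as a variable o.
  open Algebra.Solver.Ring.NaturalCoefficients.Default commutativeSemiring using (solve; _:+_; _:*_; _:=_)
  open import Relation.Binary.Reasoning.PartialOrder (TotalOrder.poset totalOrder)
  open Algebra.Properties.Monoid.Sum +-monoid using (sum-cong-≋)
  open Data.List.Extrema totalOrder using (argmin; argmin-all; f[argmin]≤f[xs])
  open Algebra.Construct.NaturalChoice.Min totalOrder using (x⊓y≤x; ⊓-comm; x≤y⇒x⊓y≈x; x≤y⇒y⊓x≈x)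

  ≥-reflexive : ∀ {x y} → x ≈ y → y ≤ x
  ≥-reflexive = ≤-reflexive ∘ ≈-sym

  +-monoʳ-≤ : ∀ z {x y} → x ≤ y → z + x ≤ z + y
  +-monoʳ-≤ z {x} {y} x≤y = begin
    z + x ≈⟨ +-comm z x ⟩
    x + z ≤⟨ +-monoˡ-≤ z x≤y ⟩
    y + z ≈⟨ +-comm y z ⟩
    z + y ∎

  +-mono-≤ : ∀ {w x y z} → w ≤ x → y ≤ z → w + y ≤ x + z
  +-mono-≤ w≤x y≤z = ≤-trans (+-monoˡ-≤ _ w≤x) (+-monoʳ-≤ _ y≤z)

  +-nonNegative : ∀ {x y} → 0# ≤ x → 0# ≤ y → 0# ≤ x + y
  +-nonNegative 0≤x 0≤y = ≤-trans (≥-reflexive (+-identityˡ 0#)) (+-mono-≤ 0≤x 0≤y)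

  x≤x+y : ∀ {x y} → 0# ≤ y → x ≤ x + y
  x≤x+y 0≤y = ≤-trans (≥-reflexive (+-identityʳ _)) (+-monoʳ-≤ _ 0≤y)

  x≤y+x : ∀ {x y} → 0# ≤ y → x ≤ y + x
  x≤y+x 0≤y = ≤-trans (x≤x+y 0≤y) (≤-reflexive (+-comm _ _))

  x+y-y≈x : ∀ x y → x + y + - y ≈ x
  x+y-y≈x x y = ≈-trans (+-assoc x y (- y)) (≈-trans (+-congˡ (-‿inverseʳ y)) (+-identityʳ x))

  x-y+y≈x : ∀ x y → x + - y + y ≈ x
  x-y+y≈x x y = ≈-trans (+-assoc x (- y) y) (≈-trans (+-congˡ (-‿inverseˡ y)) (+-identityʳ x))

  +-cancelʳ-≤ : ∀ z {x y} → x + z ≤ y + z → x ≤ y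
  +-cancelʳ-≤ z {x} {y} x+z≤y+z = begin
    x           ≈⟨ x+y-y≈x x z ⟨
    x + z + - z ≤⟨ +-monoˡ-≤ (- z) x+z≤y+z ⟩
    y + z + - z ≈⟨ x+y-y≈x y z ⟩
    y           ∎

  -- Replaces an inequality by an equation with nonnegative slack, a form that the semiring solver
  -- can handle without subtraction.
  ≤⇒∃+ : ∀ {x y} → x ≤ y → ∃[ z ] 0# ≤ z × y ≈ z + x
  ≤⇒∃+ {x} {y} x≤y = y + - x
    , ≤-trans (≥-reflexive (-‿inverseʳ x)) (+-monoˡ-≤ (- x) x≤y)
    , ≈-sym (x-y+y≈x y x)

  *-monoˡ-≤ : ∀ {z} → 0# ≤ z → ∀ {x y} → x ≤ y → x * z ≤ y * z
  *-monoˡ-≤ {z} 0≤z {x} {y} x≤y with ≤⇒∃+ x≤y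
  ... | e , 0≤e , y≈e+x = begin
    x * z         ≤⟨ x≤y+x (*-nonNegative 0≤e 0≤z) ⟩
    e * z + x * z ≈⟨ distribʳ z e x ⟨
    (e + x) * z   ≈⟨ *-congʳ y≈e+x ⟨
    y * z         ∎

  *-monoʳ-≤ : ∀ {z} → 0# ≤ z → ∀ {x y} → x ≤ y → z * x ≤ z * y
  *-monoʳ-≤ {z} 0≤z {x} {y} x≤y = begin
    z * x ≈⟨ *-comm z x ⟩
    x * z ≤⟨ *-monoˡ-≤ 0≤z x≤y ⟩
    y * z ≈⟨ *-comm y z ⟩
    z * y ∎

  square-zero : ∀ {x} → x * x ≈ 0# → x ≈ 0#
  square-zero {x} xx≈0 with x ≈? 0#
  ... | yes x≈0 = x≈0
  ... | no  x≉0 = begin-equality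
    x              ≈⟨ *-identityʳ x ⟨
    x * 1#         ≈⟨ *-congˡ (⁻¹-inverseʳ x x≉0) ⟨
    x * (x * x ⁻¹) ≈⟨ *-assoc x x (x ⁻¹) ⟨
    x * x * x ⁻¹   ≈⟨ *-congʳ xx≈0 ⟩
    0# * x ⁻¹      ≈⟨ zeroˡ (x ⁻¹) ⟩
    0#             ∎

  -- If `y ≤ x`, write `x` as `e + y`; comparing the squares forces `e * e ≤ 0#`, so `e` vanishes.
  -- The left side `x` may be negative, as 2γ - 1 is for small `γ`.
  square-cancel-≤ : ∀ {x y} → 0# ≤ y → x * x ≤ y * y → x ≤ y
  square-cancel-≤ {x} {y} 0≤y xx≤yy with total x y
  ... | inj₁ x≤y = x≤y
  ... | inj₂ y≤x with ≤⇒∃+ y≤x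
  ...   | e , 0≤e , x≈e+y = ≤-reflexive (begin-equality
    x      ≈⟨ x≈e+y ⟩
    e + y  ≈⟨ +-congʳ (square-zero (antisym ee≤0 (*-nonNegative 0≤e 0≤e))) ⟩
    0# + y ≈⟨ +-identityˡ y ⟩
    y      ∎)
    where
    ee≤0 : e * e ≤ 0#
    ee≤0 = +-cancelʳ-≤ (y * y) (begin
      e * e + y * y                 ≤⟨ x≤x+y (+-nonNegative (*-nonNegative 0≤e 0≤y) (*-nonNegative 0≤e 0≤y)) ⟩
      e * e + y * y + (e * y + e * y)
        ≈⟨ solve 2 (λ e y → e :* e :+ y :* y :+ (e :* y :+ e :* y) := (e :+ y) :* (e :+ y)) ≈-refl e y ⟩
      (e + y) * (e + y)             ≈⟨ *-cong x≈e+y x≈e+y ⟨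
      x * x                         ≤⟨ xx≤yy ⟩
      y * y                         ≈⟨ +-identityˡ (y * y) ⟨
      0# + y * y                    ∎)

  -- Avoids the division by two in `β`: the bounds are proved for `β γ + β γ`.
  double-cancel-≤ : ∀ {x y} → x + x ≤ y + y → x ≤ y
  double-cancel-≤ {x} {y} 2x≤2y with total x y
  ... | inj₁ x≤y = x≤y
  ... | inj₂ y≤x = +-cancelʳ-≤ x (≤-trans 2x≤2y (+-monoʳ-≤ y y≤x))

  -- Otherwise the slack `e` is a nonnegative -1, and its square is `1#`.
  0≤1 : 0# ≤ 1#
  0≤1 with total 0# 1#
  ... | inj₁ 0≤1 = 0≤1
  ... | inj₂ 1≤0 with ≤⇒∃+ 1≤0
  ...   | e , 0≤e , 0≈e+1 = begin
    0#                     ≤⟨ *-nonNegative 0≤e 0≤e ⟩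
    e * e                  ≈⟨ +-identityʳ (e * e) ⟨
    e * e + 0#             ≈⟨ +-congˡ 0≈e+1 ⟩
    e * e + (e + 1#)       ≈⟨ +-congˡ (+-congʳ (*-identityʳ e)) ⟨
    e * e + (e * 1# + 1#)  ≈⟨ solve 2 (λ e o → e :* e :+ (e :* o :+ o) := e :* (e :+ o) :+ o) ≈-refl e 1# ⟩
    e * (e + 1#) + 1#      ≈⟨ +-congʳ (*-congˡ 0≈e+1) ⟨
    e * 0# + 1#            ≈⟨ +-congʳ (zeroʳ e) ⟩
    0# + 1#                ≈⟨ +-identityˡ 1# ⟩
    1#                     ∎

  2≉0 : 2# ≉ 0#
  2≉0 2≈0 = 0≉1 (antisym 0≤1 (≤-trans (x≤x+y 0≤1) (≤-reflexive 2≈0)))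

  2*≈ : ∀ x → 2# * x ≈ x + x
  2*≈ x = ≈-trans (distribʳ x 1# 1#) (+-cong (*-identityˡ x) (*-identityˡ x))

  4*≈ : ∀ x → 4# * x ≈ (x + x) + (x + x)
  4*≈ x = ≈-trans (distribʳ x 2# 2#) (+-cong (2*≈ x) (2*≈ x))

  ⁻¹-nonNegative : ∀ {x} → 0# ≤ x → x ≉ 0# → 0# ≤ x ⁻¹
  ⁻¹-nonNegative {x} 0≤x x≉0 with total 0# (x ⁻¹)
  ... | inj₁ 0≤x⁻¹ = 0≤x⁻¹
  ... | inj₂ x⁻¹≤0 = ⊥-elim (0≉1 (antisym 0≤1 (begin
    1#       ≈⟨ ⁻¹-inverseʳ x x≉0 ⟨
    x * x ⁻¹ ≤⟨ *-monoʳ-≤ 0≤x x⁻¹≤0 ⟩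
    x * 0#   ≈⟨ zeroʳ x ⟩
    0#       ∎)))

  x/y*y≈x : ∀ x {y} → y ≉ 0# → x / y * y ≈ x
  x/y*y≈x x {y} y≉0 = begin-equality
    x * y ⁻¹ * y   ≈⟨ *-assoc x (y ⁻¹) y ⟩
    x * (y ⁻¹ * y) ≈⟨ *-congˡ (≈-trans (*-comm _ _) (⁻¹-inverseʳ y y≉0)) ⟩
    x * 1#         ≈⟨ *-identityʳ x ⟩
    x              ∎

  -- The constant β and its estimates

  module _ {γ} (0≤γ : 0# ≤ γ) where

    private
      σ S : Carrier
      σ = √ (4# * γ + 1#)
      S = 2# * γ + 1# + σ

    0≤2γ : 0# ≤ γ + γ
    0≤2γ = +-nonNegative 0≤γ 0≤γ

    4γ+1≈ : 4# * γ + 1# ≈ (γ + γ) + (γ + γ) + 1#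
    4γ+1≈ = +-congʳ (4*≈ γ)

    0≤4γ+1 : 0# ≤ 4# * γ + 1#
    0≤4γ+1 = ≤-trans (+-nonNegative (+-nonNegative 0≤2γ 0≤2γ) 0≤1) (≥-reflexive 4γ+1≈)

    0≤σ : 0# ≤ σ
    0≤σ = √-nonNegative 0≤4γ+1

    σσ≈ : σ * σ ≈ (γ + γ) + (γ + γ) + 1#
    σσ≈ = ≈-trans (√-square 0≤4γ+1) 4γ+1≈

    1≤σ : 1# ≤ σ
    1≤σ = square-cancel-≤ 0≤σ (begin
      1# * 1#                  ≈⟨ *-identityʳ 1# ⟩
      1#                       ≤⟨ x≤y+x (+-nonNegative 0≤2γ 0≤2γ) ⟩
      (γ + γ) + (γ + γ) + 1#   ≈⟨ σσ≈ ⟨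
      σ * σ                    ∎)

    -- Squaring 2γ - 1 ≤ σ leaves γ² ≤ 2γ, which is where `γ ≤ 2#` enters.
    2γ≤σ+1 : γ ≤ 2# → γ + γ ≤ σ + 1#
    2γ≤σ+1 γ≤2 = begin
      γ + γ  ≈⟨ e+1≈2γ ⟨
      e + 1# ≤⟨ +-monoˡ-≤ 1# (square-cancel-≤ 0≤σ (+-cancelʳ-≤ ((γ + γ) + (γ + γ)) ee≤σσ)) ⟩
      σ + 1# ∎
      where
      e : Carrier
      e = γ + γ + - 1#

      e+1≈2γ : e + 1# ≈ γ + γ
      e+1≈2γ = x-y+y≈x (γ + γ) 1#

      γγ≤2γ : γ * γ ≤ γ + γ
      γγ≤2γ = ≤-trans (*-monoˡ-≤ 0≤γ γ≤2) (≤-reflexive (2*≈ γ))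

      -- Adding 4γ = 2(e + 1) turns e² into (e + 1)² + 1 = 4γ² + 1, free of subtraction.
      ee≤σσ : e * e + ((γ + γ) + (γ + γ)) ≤ σ * σ + ((γ + γ) + (γ + γ))
      ee≤σσ = begin
        e * e + ((γ + γ) + (γ + γ))              ≈⟨ +-congˡ (+-cong e+1≈2γ e+1≈2γ) ⟨
        e * e + ((e + 1#) + (e + 1#))
          ≈⟨ +-congˡ (+-cong (+-cong (*-identityʳ e) (*-identityʳ 1#)) (+-congʳ (*-identityʳ e))) ⟨
        e * e + ((e * 1# + 1# * 1#) + (e * 1# + 1#))
          ≈⟨ solve 2 (λ e o → e :* e :+ ((e :* o :+ o :* o) :+ (e :* o :+ o))
                           := (e :+ o) :* (e :+ o) :+ o) ≈-refl e 1# ⟩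
        (e + 1#) * (e + 1#) + 1#                 ≈⟨ +-congʳ (*-cong e+1≈2γ e+1≈2γ) ⟩
        (γ + γ) * (γ + γ) + 1#
          ≈⟨ +-congʳ (solve 1 (λ γ → (γ :+ γ) :* (γ :+ γ) := (γ :* γ :+ γ :* γ) :+ (γ :* γ :+ γ :* γ)) ≈-refl γ) ⟩
        (γ * γ + γ * γ) + (γ * γ + γ * γ) + 1#
          ≤⟨ +-monoˡ-≤ 1# (+-mono-≤ (+-mono-≤ γγ≤2γ γγ≤2γ) (+-mono-≤ γγ≤2γ γγ≤2γ)) ⟩
        ((γ + γ) + (γ + γ)) + ((γ + γ) + (γ + γ)) + 1#
          ≈⟨ solve 2 (λ u o → u :+ u :+ o := (u :+ o) :+ u) ≈-refl ((γ + γ) + (γ + γ)) 1# ⟩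
        (γ + γ) + (γ + γ) + 1# + ((γ + γ) + (γ + γ)) ≈⟨ +-congʳ σσ≈ ⟨
        σ * σ + ((γ + γ) + (γ + γ))              ∎

    -- The radicand 4γ + 1 equals 9 at `γ` = 2 and grows with `γ`.
    3≤σ : 2# ≤ γ → 2# + 1# ≤ σ
    3≤σ 2≤γ = square-cancel-≤ 0≤σ (begin
      (2# + 1#) * (2# + 1#)
        ≈⟨ solve 1 (λ o → (o :+ o :+ o) :* (o :+ o :+ o) := (o :+ o :+ (o :+ o)) :* (o :+ o) :+ o :* o) ≈-refl 1# ⟩
      4# * 2# + 1# * 1#   ≈⟨ +-cong (4*≈ 2#) (*-identityʳ 1#) ⟩
      (2# + 2#) + (2# + 2#) + 1# ≤⟨ +-monoˡ-≤ 1# (+-mono-≤ (+-mono-≤ 2≤γ 2≤γ) (+-mono-≤ 2≤γ 2≤γ)) ⟩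
      (γ + γ) + (γ + γ) + 1# ≈⟨ σσ≈ ⟨
      σ * σ               ∎)

    β+β≈ : β γ + β γ ≈ S
    β+β≈ = begin-equality
      1# * 2# ⁻¹ * S + 1# * 2# ⁻¹ * S
        ≈⟨ solve 3 (λ o h S → o :* h :* S :+ o :* h :* S := (o :+ o) :* h :* S) ≈-refl 1# (2# ⁻¹) S ⟩
      2# * 2# ⁻¹ * S ≈⟨ *-congʳ (⁻¹-inverseʳ 2# 2≉0) ⟩
      1# * S         ≈⟨ *-identityˡ S ⟩
      S              ∎

    0≤S : 0# ≤ S
    0≤S = +-nonNegative (+-nonNegative (≤-trans 0≤2γ (≥-reflexive (2*≈ γ))) 0≤1) 0≤σ

    β-nonNegative : 0# ≤ β γ
    β-nonNegative = double-cancel-≤ (begin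
      0# + 0#    ≈⟨ +-identityˡ 0# ⟩
      0#         ≤⟨ 0≤S ⟩
      S          ≈⟨ β+β≈ ⟨
      β γ + β γ  ∎)

    -- It suffices that σ ≤ 2γ + 1, and (2γ + 1)² exceeds the radicand by 4γ².
    β≤2γ+1 : β γ ≤ 2# * γ + 1#
    β≤2γ+1 = double-cancel-≤ (begin
      β γ + β γ                       ≈⟨ β+β≈ ⟩
      2# * γ + 1# + σ
        ≤⟨ +-monoʳ-≤ (2# * γ + 1#) (square-cancel-≤ (+-nonNegative (≤-trans 0≤2γ (≥-reflexive (2*≈ γ))) 0≤1) σσ≤) ⟩
      2# * γ + 1# + (2# * γ + 1#)     ∎)
      where
      σσ≤ : σ * σ ≤ (2# * γ + 1#) * (2# * γ + 1#)
      σσ≤ = begin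
        σ * σ                      ≈⟨ σσ≈ ⟩
        (γ + γ) + (γ + γ) + 1#     ≤⟨ x≤y+x (*-nonNegative 0≤2γ 0≤2γ) ⟩
        (γ + γ) * (γ + γ) + ((γ + γ) + (γ + γ) + 1#)
          ≈⟨ +-congˡ (+-cong (+-cong (*-identityʳ _) (*-identityʳ _)) (*-identityʳ _)) ⟨
        (γ + γ) * (γ + γ) + ((γ + γ) * 1# + (γ + γ) * 1# + 1# * 1#)
          ≈⟨ solve 2 (λ u o → u :* u :+ (u :* o :+ u :* o :+ o :* o) := (u :+ o) :* (u :+ o)) ≈-refl (γ + γ) 1# ⟩
        (γ + γ + 1#) * (γ + γ + 1#) ≈⟨ *-cong (+-congʳ (2*≈ γ)) (+-congʳ (2*≈ γ)) ⟨
        (2# * γ + 1#) * (2# * γ + 1#) ∎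

    -- The two bounds on `M` yield the factors 2γ and γ + 2 at the threshold `γ` = 2, where both
    -- equal `β γ` = 4; hence the case split there.
    ≤β* : ∀ {m τ W M} → 0# ≤ m → m ≤ τ → W ≈ γ * m → M + m ≤ τ + W → M ≤ τ + τ → W + M ≤ β γ * τ
    ≤β* {m} {τ} {W} {M} 0≤m m≤τ W≈γm M+m≤τ+W M≤2τ = double-cancel-≤ (begin
      W + M + (W + M)        ≤⟨ ≤Sτ (total γ 2#) ⟩
      S * τ                  ≈⟨ *-congʳ β+β≈ ⟨
      (β γ + β γ) * τ        ≈⟨ distribʳ τ (β γ) (β γ) ⟩
      β γ * τ + β γ * τ      ∎)
      where
      0≤τ : 0# ≤ τ
      0≤τ = ≤-trans 0≤m m≤τ

      ≤Sτ : γ ≤ 2# ⊎ 2# ≤ γ → W + M + (W + M) ≤ S * τ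
      -- The slack `p` is σ - 1. Of two terms 2γm, one is raised to (σ + 1)m = (p + 2)m. Its part 2m
      -- matches the `m + m` added at the outset, and the remaining coefficient 2γ + p is
      -- nonnegative, so `m` may be raised to `τ`.
      ≤Sτ (inj₁ γ≤2) with ≤⇒∃+ 1≤σ
      ... | p , 0≤p , σ≈p+1 = +-cancelʳ-≤ (m + m) (begin
        W + M + (W + M) + (m + m)
          ≈⟨ solve 3 (λ W M m → W :+ M :+ (W :+ M) :+ (m :+ m) := (M :+ m) :+ (M :+ m) :+ (W :+ W)) ≈-refl W M m ⟩
        (M + m) + (M + m) + (W + W)       ≤⟨ +-monoˡ-≤ (W + W) (+-mono-≤ M+m≤τ+W M+m≤τ+W) ⟩
        (τ + W) + (τ + W) + (W + W)       ≈⟨ +-cong (+-cong (+-congˡ W≈γm) (+-congˡ W≈γm)) (+-cong W≈γm W≈γm) ⟩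
        (τ + γ * m) + (τ + γ * m) + (γ * m + γ * m)
          ≈⟨ solve 3 (λ τ γ m → (τ :+ γ :* m) :+ (τ :+ γ :* m) :+ (γ :* m :+ γ :* m)
                             := τ :+ τ :+ ((γ :+ γ) :* m :+ (γ :+ γ) :* m)) ≈-refl τ γ m ⟩
        τ + τ + ((γ + γ) * m + (γ + γ) * m)
          ≤⟨ +-monoʳ-≤ (τ + τ) (+-monoʳ-≤ ((γ + γ) * m) (*-monoˡ-≤ 0≤m (2γ≤σ+1 γ≤2))) ⟩
        τ + τ + ((γ + γ) * m + (σ + 1#) * m)  ≈⟨ +-congˡ (+-congˡ (*-congʳ (+-congʳ σ≈p+1))) ⟩
        τ + τ + ((γ + γ) * m + (p + 1# + 1#) * m)
          ≈⟨ +-congˡ (solve 4 (λ γ m p o → (γ :+ γ) :* m :+ (p :+ o :+ o) :* m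
                                     := (γ :+ γ :+ p) :* m :+ (o :* m :+ o :* m)) ≈-refl γ m p 1#) ⟩
        τ + τ + ((γ + γ + p) * m + (1# * m + 1# * m))
          ≈⟨ +-congˡ (+-congˡ (+-cong (*-identityˡ m) (*-identityˡ m))) ⟩
        τ + τ + ((γ + γ + p) * m + (m + m))
          ≤⟨ +-monoʳ-≤ (τ + τ) (+-monoˡ-≤ (m + m) (*-monoʳ-≤ (+-nonNegative 0≤2γ 0≤p) m≤τ)) ⟩
        τ + τ + ((γ + γ + p) * τ + (m + m))  ≈⟨ +-congʳ (+-cong (*-identityˡ τ) (*-identityˡ τ)) ⟨
        1# * τ + 1# * τ + ((γ + γ + p) * τ + (m + m))
          ≈⟨ solve 5 (λ τ γ p m o → o :* τ :+ o :* τ :+ ((γ :+ γ :+ p) :* τ :+ (m :+ m))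
                                 := (γ :+ γ :+ o :+ (p :+ o)) :* τ :+ (m :+ m)) ≈-refl τ γ p m 1# ⟩
        (γ + γ + 1# + (p + 1#)) * τ + (m + m) ≈⟨ +-congʳ (*-congʳ (+-cong (+-congʳ (2*≈ γ)) σ≈p+1)) ⟨
        S * τ + (m + m)                   ∎)
      -- Twice γ + 2 is 2γ + 1 + 3, and `3≤σ` bounds the 3.
      ≤Sτ (inj₂ 2≤γ) = begin
        W + M + (W + M)                   ≤⟨ +-mono-≤ (+-mono-≤ W≤γτ M≤2τ) (+-mono-≤ W≤γτ M≤2τ) ⟩
        γ * τ + (τ + τ) + (γ * τ + (τ + τ)) ≈⟨ +-cong (+-congˡ (2*≈ τ)) (+-congˡ (2*≈ τ)) ⟨
        γ * τ + 2# * τ + (γ * τ + 2# * τ)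
          ≈⟨ solve 3 (λ γ τ o → γ :* τ :+ (o :+ o) :* τ :+ (γ :* τ :+ (o :+ o) :* τ)
                             := (γ :+ γ :+ o :+ (o :+ o :+ o)) :* τ) ≈-refl γ τ 1# ⟩
        (γ + γ + 1# + (2# + 1#)) * τ      ≤⟨ *-monoˡ-≤ 0≤τ (+-monoʳ-≤ (γ + γ + 1#) (3≤σ 2≤γ)) ⟩
        (γ + γ + 1# + σ) * τ              ≈⟨ *-congʳ (+-congʳ (+-congʳ (2*≈ γ))) ⟨
        S * τ                             ∎
        where
        W≤γτ : W ≤ γ * τ
        W≤γτ = ≤-trans (≤-reflexive W≈γm) (*-monoʳ-≤ 0≤γ m≤τ)

  -- Weights of edge lists and of graphs

  ω : (Fin n → Fin n → Carrier) → List (Edge n) → Carrier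
  ω w []             = 0#
  ω w ((x , y) ∷ es) = w x y + ω w es

  ω-++ : ∀ (w : Fin n → Fin n → Carrier) es fs → ω w (es ++ fs) ≈ ω w es + ω w fs
  ω-++ w []             fs = ≈-sym (+-identityˡ _)
  ω-++ w ((x , y) ∷ es) fs = ≈-trans (+-congˡ (ω-++ w es fs)) (≈-sym (+-assoc _ _ _))

  sum-nonNegative : ∀ {f : Fin n → Carrier} → (∀ i → 0# ≤ f i) → 0# ≤ sum f
  sum-nonNegative {ℕ.zero}  0≤f = ≤-refl
  sum-nonNegative {ℕ.suc n} 0≤f = +-nonNegative (0≤f zero) (sum-nonNegative (0≤f ∘ suc))

  sum-zero : ∀ {f : Fin n → Carrier} → (∀ i → f i ≈ 0#) → sum f ≈ 0#
  sum-zero {ℕ.zero}  f≈0 = ≈-refl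
  sum-zero {ℕ.suc n} f≈0 = ≈-trans (+-cong (f≈0 zero) (sum-zero (f≈0 ∘ suc))) (+-identityˡ 0#)

  sum-update : ∀ {f g : Fin n → Carrier} {a} i → f i ≈ a + g i → (∀ j → j ≢ i → f j ≈ g j) →
               sum f ≈ a + sum g
  sum-update {ℕ.suc n} zero f≈a+g f≈g =
    ≈-trans (+-cong f≈a+g (sum-cong-≋ {n} λ j → f≈g (suc j) λ ())) (+-assoc _ _ _)
  sum-update {f = f} {g} {a} (suc i) f≈a+g f≈g = ≈-trans
    (+-cong (f≈g zero λ ()) (sum-update i f≈a+g λ j j≢i → f≈g (suc j) (j≢i ∘ Fin.suc-injective)))
    (solve 3 (λ g₀ a s → g₀ :+ (a :+ s) := a :+ (g₀ :+ s)) ≈-refl (g zero) a (sum (g ∘ suc)))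

  edges : Graph n → List (Edge n)
  edges {n} G = filter (λ (x , y) → (x <? y) ×-dec adj? G x y) (cartesianProduct (allFin n) (allFin n))

  module _ (G : Graph n) where

    private
      edge? : ∀ (e : Edge n) → Dec _
      edge? (x , y) = (x <? y) ×-dec adj? G x y

    edges-adj : All (uncurry (Adj G)) (edges G)
    edges-adj = All.map proj₂ (all-filter edge? (cartesianProduct (allFin n) (allFin n)))

    edges-cover : ∀ {x y} → Adj G x y → Any (Same (x , y)) (edges G)
    edges-cover {x} {y} xy with Fin.<-cmp x y
    ... | tri< x<y _ _ = Any.map (λ { refl → straight })
      (∈-filter⁺ edge? (∈-cartesianProduct⁺ (∈-allFin x) (∈-allFin y)) (x<y , xy))
    ... | tri≈ _ x≡y _ = ⊥-elim (irrefl G x≡y xy)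
    ... | tri> _ _ y<x = Any.map (λ { refl → crossed })
      (∈-filter⁺ edge? (∈-cartesianProduct⁺ (∈-allFin y) (∈-allFin x)) (y<x , symm G xy))

    edges-distinct : AllPairs Distinct (edges G)
    edges-distinct = distinct (All.map proj₁ (all-filter edge? (cartesianProduct (allFin n) (allFin n))))
      (Unique.filter⁺ edge? (Unique.cartesianProduct⁺ (Unique.allFin⁺ n) (Unique.allFin⁺ n)))
      where
      distinct : ∀ {es : List (Edge n)} → All (uncurry Fin._<_) es → Unique es → AllPairs Distinct es
      distinct []         []        = []
      distinct (x<y ∷ <s) (e∉ ∷ u) = All.zipWith
        (λ { (_ , e≢f) straight → e≢f refl ; (y<x , _) crossed → Fin.<-asym x<y y<x }) (<s , e∉)
        ∷ distinct <s u

  module _ (w : Fin n → Fin n → Carrier) where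

    private
      term : Graph n → Fin n → Fin n → Carrier
      term G x y = if does (x <? y) ∧ does (adj? G x y) then w x y else 0#

      term-true : ∀ G {x y} → x Fin.< y → Adj G x y → term G x y ≡ w x y
      term-true G {x} {y} x<y xy =
        cong (λ b → if b then w x y else 0#) (dec-true ((x <? y) ×-dec adj? G x y) (x<y , xy))

      term-false : ∀ G {x y} → ¬ (x Fin.< y × Adj G x y) → term G x y ≡ 0#
      term-false G {x} {y} ¬xy =
        cong (λ b → if b then w x y else 0#) (dec-false ((x <? y) ×-dec adj? G x y) ¬xy)

      term-cong : ∀ G H {x y} → (x Fin.< y → Adj G x y → Adj H x y) → (x Fin.< y → Adj H x y → Adj G x y) →
                  term G x y ≡ term H x y
      term-cong G H {x} {y} to from = cong (λ b → if b then w x y else 0#)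
        (does-⇔ (mk⇔ (λ (x<y , a) → x<y , to x<y a) (λ (x<y , a) → x<y , from x<y a))
          ((x <? y) ×-dec adj? G x y) ((x <? y) ×-dec adj? H x y))

      -- Only the entry at the increasing orientation changes, so `sum-update` applies once to the
      -- outer and once to the inner sum. Keeping `e` apart from `(x , y)` covers both orientations
      -- of the removed edge.
      weight-remove< : ∀ G {x y e} → x Fin.< y → Adj G x y → Same (x , y) e →
                       weight w G ≈ w x y + weight w (G ∖ e)
      weight-remove< G {x} {y} {e} x<y xy s =
        sum-update x
          (sum-update y at λ v v≢y → other (v≢y ∘ cong proj₂))
          λ u u≢x → sum-cong-≋ {n} λ v → other (u≢x ∘ cong proj₁)
        where
        at : term G x y ≈ w x y + term (G ∖ e) x y
        at = begin-equality
          term G x y                 ≡⟨ term-true G x<y xy ⟩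
          w x y                      ≈⟨ +-identityʳ (w x y) ⟨
          w x y + 0#                 ≡⟨ cong (w x y +_) (term-false (G ∖ e) λ { (_ , _ , ¬s) → ¬s s }) ⟨
          w x y + term (G ∖ e) x y   ∎

        other : ∀ {u v} → (u , v) ≢ (x , y) → term G u v ≈ term (G ∖ e) u v
        other {u} {v} ≢xy = ≈-reflexive (term-cong G (G ∖ e)
          (λ u<v uv → uv , λ s′ → ≢xy (same-ordered u<v x<y s′ s)) (λ _ → proj₁))

      weight-empty : ∀ G → (∀ {x y} → ¬ Adj G x y) → weight w G ≈ 0#
      weight-empty G ¬xy = sum-zero {n} λ x → sum-zero {n} λ y → ≈-reflexive (term-false G (¬xy ∘ proj₂))

    module _ (w-sym : ∀ x y → w x y ≈ w y x) (w-nonNegative : ∀ {x y} → x ≢ y → 0# ≤ w x y) where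

      weight-nonNegative : ∀ G → 0# ≤ weight w G
      weight-nonNegative G = sum-nonNegative {n} λ x → sum-nonNegative {n} λ y → nonNegative x y
        where
        nonNegative : ∀ x y → 0# ≤ term G x y
        nonNegative x y with (x <? y) ×-dec adj? G x y
        ... | yes (x<y , xy) = ≤-trans (w-nonNegative (Fin.<⇒≢ x<y))
                                       (≥-reflexive (≈-reflexive (term-true G x<y xy)))
        ... | no ¬xy         = ≥-reflexive (≈-reflexive (term-false G ¬xy))

      weight-remove : ∀ G {x y} → Adj G x y → weight w G ≈ w x y + weight w (G ∖ (x , y))
      weight-remove G {x} {y} xy with Fin.<-cmp x y
      ... | tri< x<y _ _ = weight-remove< G x<y xy straight
      ... | tri≈ _ x≡y _ = ⊥-elim (irrefl G x≡y xy)
      ... | tri> _ _ y<x = ≈-trans (weight-remove< G y<x (symm G xy) crossed) (+-congʳ (w-sym y x))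

      -- Take the listed edges out of `G` one at a time: since they are distinct, the later ones are
      -- still there, and what is left over has nonnegative weight.
      ω≤weight : ∀ G {es} → All (uncurry (Adj G)) es → AllPairs Distinct es → ω w es ≤ weight w G
      ω≤weight G []        []       = weight-nonNegative G
      ω≤weight G {(x , y) ∷ es} (xy ∷ adj) (d ∷ ds) = begin
        w x y + ω w es                 ≤⟨ +-monoʳ-≤ (w x y) (ω≤weight (G ∖ (x , y))
                                            (All.zipWith (λ (a , ¬s) → a , ¬s ∘ same-sym) (adj , d)) ds) ⟩
        w x y + weight w (G ∖ (x , y)) ≈⟨ weight-remove G xy ⟨
        weight w G                     ∎

      -- Take the listed edges out of `G` until it is empty. Repetitions and pairs that are not
      -- edges only make the list heavier.
      weight≤ω : ∀ G {es} → (∀ {x y} → Adj G x y → Any (Same (x , y)) es) →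
                 All (λ (x , y) → 0# ≤ w x y) es → weight w G ≤ ω w es
      weight≤ω G {[]} cover [] = ≤-reflexive (weight-empty G λ xy → case cover xy of λ ())
      weight≤ω G {(x , y) ∷ es} cover (0≤w ∷ 0≤ws) with adj? G x y
      ... | yes xy = begin
        weight w G                     ≈⟨ weight-remove G xy ⟩
        w x y + weight w (G ∖ (x , y)) ≤⟨ +-monoʳ-≤ (w x y) (weight≤ω (G ∖ (x , y)) cover′ 0≤ws) ⟩
        w x y + ω w es                 ∎
        where
        cover′ : ∀ {u v} → Adj (G ∖ (x , y)) u v → Any (Same (u , v)) es
        cover′ (uv , ¬s) with cover uv
        ... | here s  = ⊥-elim (¬s s)
        ... | there s = s
      ... | no ¬xy = ≤-trans (weight≤ω G cover′ 0≤ws) (x≤y+x 0≤w)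
        where
        cover′ : ∀ {u v} → Adj G u v → Any (Same (u , v)) es
        cover′ uv with cover uv
        ... | here straight = ⊥-elim (¬xy uv)
        ... | here crossed  = ⊥-elim (¬xy (symm G uv))
        ... | there s       = s

      ω-edges≤weight : ∀ G → ω w (edges G) ≤ weight w G
      ω-edges≤weight G = ω≤weight G (edges-adj G) (edges-distinct G)

      weight≤ω-edges : ∀ G → weight w G ≤ ω w (edges G)
      weight≤ω-edges G = weight≤ω G (edges-cover G)
        (All.map (λ {(x , y)} xy → w-nonNegative λ x≡y → irrefl G x≡y xy) (edges-adj G))

      module _ {r : Fin n} where

        weight-grown : ∀ {es} → Grown r es → weight w (edgeGraph es) ≤ ω w es
        weight-grown {es} g = weight≤ω (edgeGraph es) proj₂
          (All.map (λ {(x , y)} → w-nonNegative) (grown-irreflexive g))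

        -- Reduces an upper bound on the coarse tree to the construction of one rooted spanning
        -- tree.
        MST≤ω : ∀ {T es} → IsMST w T → Grown r es → (∀ x → x ∈ vertices r es) → weight w T ≤ ω w es
        MST≤ω (_ , T-min) g spans = ≤-trans (T-min _ (grown-spanning g spans)) (weight-grown g)

        -- Every spanning tree weighs at least as much as some grown one, and there
        -- are only finitely many of those.
        MST-exists : ∃[ T ] IsMST w T
        MST-exists = edgeGraph best , grown-spanning (proj₁ best-candidate) (proj₂ best-candidate)
                   , λ T′ spanning →
          let es , g , adj , spans = growAll (λ u → IsTreeOn.connected spanning tt tt)
              es∈ = ∈-filter⁺ candidate? (∈-edgeLists (ℕ.<⇒≤ (grown-length g))) (g , spans)
          in begin
            weight w (edgeGraph best) ≤⟨ weight-grown (proj₁ best-candidate) ⟩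
            ω w best                  ≤⟨ All.lookup (f[argmin]≤f[xs] {f = ω w} initial candidates) es∈ ⟩
            ω w es                    ≤⟨ ω≤weight T′ adj (grown-distinct g) ⟩
            weight w T′               ∎
          where
          Candidate : List (Edge n) → Set
          Candidate es = Grown r es × (∀ x → x ∈ vertices r es)

          candidate? : ∀ es → Dec (Candidate es)
          candidate? es = grown? r es ×-dec all? λ x → decMember _≟_ x (vertices r es)

          candidates : List (List (Edge n))
          candidates = filter candidate? (edgeLists n)

          -- The default value for `argmin`: with all pairs allowed, growing produces a star around
          -- the root, which is a candidate.
          star : ∃[ es ] Grown r es × All (λ _ → ⊤) es × (∀ x → x ∈ vertices r es)
          star = growAll {R = λ _ _ → ⊤} λ _ → tt ◅ ε

          initial best : List (Edge n)
          initial = proj₁ star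
          best  = argmin (ω w) initial candidates

          best-candidate : Candidate best
          best-candidate = argmin-all (ω w)
            (proj₁ (proj₂ star) , proj₂ (proj₂ (proj₂ star))) (all-filter candidate? (edgeLists n))

  -- Metric forest completion

  -- A finite overlap has a nonzero denominator, whereas an empty sum is zero. The component of this
  -- point serves as the root of the trees on the components.
  point : ∀ (w : Fin n → Fin n → Carrier) G → weight w G ≉ 0# → Fin n
  point {ℕ.zero}  w G ≉0 = ⊥-elim (≉0 ≈-refl)
  point {ℕ.suc _} w G ≉0 = zero

  module _ (X : FiniteMetricSpace n) where

    open FiniteMetricSpace X
    open IsGeneralMetric isMetric using (nonNegative; ≈⇒0; triangle) renaming (sym to d-sym)

    d-nonNegative : ∀ {x y} → x ≢ y → 0# ≤ d x y
    d-nonNegative _ = nonNegative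

    -- Triangle inequality along the path from the root; edges off that path only increase the right
    -- side.
    d-rootˡ : ∀ {r es} → Grown r es → ∀ {x} → x ∈ vertices r es → d r x ≤ ω d es
    d-rootˡ []                              (here refl) = ≤-reflexive (≈⇒0 refl)
    d-rootˡ {r} (grow {p} {v} {es} p∈ _ g) (here refl) = begin
      d r v            ≤⟨ triangle r p v ⟩
      d r p + d p v    ≤⟨ +-monoˡ-≤ (d p v) (d-rootˡ g p∈) ⟩
      ω d es + d p v   ≈⟨ +-comm (ω d es) (d p v) ⟩
      d p v + ω d es   ∎
    d-rootˡ (grow _ _ g) (there x∈) = ≤-trans (d-rootˡ g x∈) (x≤y+x nonNegative)

    walkLength : Fin n → List (Fin n) → Carrier
    walkLength x []       = 0#
    walkLength x (y ∷ ys) = d x y + walkLength y ys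

    -- At an occurrence of `p` the walk makes the excursion from `p` to `v` and back.
    insertDetour : ∀ {p x} v ws → p ∈ x ∷ ws →
      ∃[ ws′ ] walkLength x ws′ ≤ walkLength x ws + (d p v + d p v)
               × (∀ {u} → u ∈ x ∷ ws → u ∈ x ∷ ws′) × v ∈ x ∷ ws′
    insertDetour {p} v ws (here refl) = v ∷ p ∷ ws
      , ≤-reflexive (begin-equality
          d p v + (d v p + walkLength p ws)  ≈⟨ +-congˡ (+-congʳ (d-sym v p)) ⟩
          d p v + (d p v + walkLength p ws)
            ≈⟨ solve 2 (λ a l → a :+ (a :+ l) := l :+ (a :+ a)) ≈-refl (d p v) (walkLength p ws) ⟩
          walkLength p ws + (d p v + d p v)  ∎)
      , (λ { (here eq) → here eq ; (there u∈) → there (there (there u∈)) })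
      , there (here refl)
    insertDetour {p} {x} v (y ∷ ys) (there p∈) =
      let ws′ , len≤ , keep , v∈ = insertDetour v ys p∈
      in y ∷ ws′
       , ≤-trans (+-monoʳ-≤ (d x y) len≤) (≥-reflexive (+-assoc _ _ _))
       , (λ { (here eq) → here eq ; (there u∈) → there (keep u∈) })
       , there v∈

    -- Going around the tree traverses every edge twice.
    tour : ∀ {r es} → Grown r es →
      ∃[ ws ] walkLength r ws ≤ ω d es + ω d es × (∀ {u} → u ∈ vertices r es → u ∈ r ∷ ws)
    tour [] = [] , ≥-reflexive (+-identityˡ 0#) , λ u∈ → u∈
    tour {r} (grow {p} {v} {es} p∈ _ g) =
      let ws  , len≤  , covers    = tour g
          ws′ , len≤′ , keep , v∈ = insertDetour v ws (covers p∈)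
      in ws′
       , (begin
           walkLength r ws′                         ≤⟨ len≤′ ⟩
           walkLength r ws + (d p v + d p v)        ≤⟨ +-monoˡ-≤ (d p v + d p v) len≤ ⟩
           ω d es + ω d es + (d p v + d p v)
             ≈⟨ solve 2 (λ s a → s :+ s :+ (a :+ a) := (a :+ s) :+ (a :+ s)) ≈-refl (ω d es) (d p v) ⟩
           (d p v + ω d es) + (d p v + ω d es)      ∎)
       , λ { (here refl) → v∈ ; (there u∈) → keep (covers u∈) }

    -- Existence of a run

    module _ (F : InitialForest n t) where

      open InitialForest F

      -- All minima range over finite nonempty lists. The argument is the root from which candidates
      -- for the coarse tree are grown.
      initialRun : Fin t → Run X F
      initialRun c = record
        { rep         = rep
        ; rep-∈       = rep-∈
        ; toRep       = toRep
        ; toRep-min   = λ {i} {j} _ → (nearest i j , nearest-∈ i j , ≈-refl) , λ x x∈ →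
            All.lookup (f[argmin]≤f[xs] {f = λ x → d x (rep j)} (rep i) (members i))
              (∈-filter⁺ (λ x → component x ≟ i) (∈-allFin x) x∈)
        ; link        = link
        ; link-∈      = λ i≢j → proj₁ (link-recorded i≢j)
        ; link-rep    = λ i≢j → proj₁ (proj₂ (proj₂ (link-recorded i≢j)))
        ; link-attain = λ i≢j → proj₂ (proj₂ (proj₂ (link-recorded i≢j)))
        ; coarseTree  = proj₁ coarse
        ; coarse-MST  = proj₂ coarse
        }
        where
        rep : Fin t → Fin n
        rep i = proj₁ (nonempty i)

        rep-∈ : ∀ i → component (rep i) ≡ i
        rep-∈ i = proj₂ (nonempty i)

        members : Fin t → List (Fin n)
        members i = filter (λ x → component x ≟ i) (allFin n)

        nearest : Fin t → Fin t → Fin n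
        nearest i j = argmin (λ x → d x (rep j)) (rep i) (members i)

        nearest-∈ : ∀ i j → component (nearest i j) ≡ i
        nearest-∈ i j = argmin-all (λ x → d x (rep j)) (rep-∈ i) (all-filter (λ x → component x ≟ i) (allFin n))

        toRep ŵ : Fin t → Fin t → Carrier
        toRep i j = d (nearest i j) (rep j)
        ŵ i j = toRep i j ⊓ toRep j i

        Recorded : Fin t → Fin t → Fin n → Fin n → Set _
        Recorded i j x y = component x ≡ i × component y ≡ j × (x ≡ rep i ⊎ y ≡ rep j) × d x y ≈ ŵ i j

        record-pair : ∀ i j → ∃[ x ] ∃[ y ] Recorded i j x y
        record-pair i j = case total (toRep i j) (toRep j i) of λ where
          (inj₁ ij≤ji) → nearest i j , rep j , nearest-∈ i j , rep-∈ j , inj₂ refl , ≈-sym (x≤y⇒x⊓y≈x ij≤ji)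
          (inj₂ ji≤ij) → rep i , nearest j i , rep-∈ i , nearest-∈ j i , inj₁ refl
                       , ≈-trans (d-sym _ _) (≈-sym (x≤y⇒y⊓x≈x ji≤ij))

        recorded-sym : ∀ {i j x y} → Recorded i j x y → Recorded j i y x
        recorded-sym {i} {j} (x∈ , y∈ , r , eq) = y∈ , x∈ , Sum.swap r
          , ≈-trans (d-sym _ _) (≈-trans eq (⊓-comm (toRep i j) (toRep j i)))

        -- The pair is chosen once, in increasing order of the indices, and read backwards for the
        -- other order. Otherwise a tie could make `link i j` and `link j i` come from different
        -- pairs. Values on the diagonal are dummies.
        link : Fin t → Fin t → Fin n
        link i j with i <? j
        ... | yes _ = proj₁ (record-pair i j)
        ... | no  _ = proj₁ (proj₂ (record-pair j i))

        link-recorded : ∀ {i j} → i ≢ j → Recorded i j (link i j) (link j i)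
        link-recorded {i} {j} i≢j with i <? j | j <? i
        ... | yes i<j | yes j<i = ⊥-elim (Fin.<-asym i<j j<i)
        ... | yes _   | no  _   = proj₂ (proj₂ (record-pair i j))
        ... | no  _   | yes _   = recorded-sym {j} {i} (proj₂ (proj₂ (record-pair j i)))
        ... | no i≮j  | no j≮i  = case Fin.<-cmp i j of λ where
          (tri< i<j _ _) → ⊥-elim (i≮j i<j)
          (tri≈ _ i≡j _) → ⊥-elim (i≢j i≡j)
          (tri> _ _ j<i) → ⊥-elim (j≮i j<i)

        coarse : ∃[ T ] IsMST ŵ T
        coarse = MST-exists ŵ (λ i j → ⊓-comm (toRep i j) (toRep j i))
          (λ i≢j → ≤-trans nonNegative (≤-reflexive (proj₂ (proj₂ (proj₂ (link-recorded i≢j))))))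
          {c}

      -- The output is a spanning tree

      module _ (R : Run X F) where

        open Run R

        private
          C : Graph t
          C = coarseTree

          adj⇒≢ : ∀ {i j} → Adj C i j → i ≢ j
          adj⇒≢ ij i≡j = irrefl C i≡j ij

          coarse-bridges : Bridges C
          coarse-bridges = acyclic⇒bridges (IsTreeOn.acyclic (proj₁ coarse-MST))

          tree-bridges : ∀ i → Bridges (tree i)
          tree-bridges i = acyclic⇒bridges (IsTreeOn.acyclic (isTree i))

          link-component : ∀ {i j} → Adj C i j → component (link i j) ≡ i
          link-component ij = link-∈ (adj⇒≢ ij)

        ŵ-sym : ∀ i j → ŵ i j ≈ ŵ j i
        ŵ-sym i j = ⊓-comm (toRep i j) (toRep j i)

        ŵ-nonNegative : ∀ {i j} → i ≢ j → 0# ≤ ŵ i j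
        ŵ-nonNegative i≢j = ≤-trans nonNegative (≤-reflexive (link-attain i≢j))

        ŵ≤toRep : ∀ {i j} → i ≢ j → ∀ {x} → component x ≡ i → ŵ i j ≤ d x (rep j)
        ŵ≤toRep {i} {j} i≢j x∈ = ≤-trans (x⊓y≤x (toRep i j) (toRep j i)) (proj₂ (toRep-min i≢j) _ x∈)

        -- A walk in the coarse tree is lifted to points: within each component, its initial tree
        -- leads to the next recorded point.
        output-connected : ∀ x y → Star (Adj output) x y
        output-connected x y = along (IsTreeOn.connected (proj₁ coarse-MST) tt tt) refl refl
          where
          inside : ∀ {i u v} → component u ≡ i → component v ≡ i → Star (Adj output) u v
          inside {i} u∈ v∈ = Star.map (λ e → inj₁ (i , e)) (IsTreeOn.connected (isTree i) u∈ v∈)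

          along : ∀ {i j u v} → Star (Adj C) i j → component u ≡ i → component v ≡ j → Star (Adj output) u v
          along ε                         u∈ v∈ = inside u∈ v∈
          along (_◅_ {i} {k} ik s) u∈ v∈ =
            inside u∈ (link-component ik)
            ◅◅ inj₂ (i , k , ik , refl , refl)
            ◅ along s (link-component (symm C ik)) v∈

        -- Contracting the components turns a detour around the recorded pair into a detour around
        -- the coarse edge: forest edges vanish, and a recorded pair other than the removed one
        -- comes from another coarse edge.
        completion-bridge : ∀ {i j} → Adj C i j →
                            ¬ Star (Adj (output ∖ (link i j , link j i))) (link j i) (link i j)
        completion-bridge {i} {j} ij detour = coarse-bridges ij
          (subst₂ (Star (Adj (C ∖ (i , j)))) (link-component (symm C ij)) (link-component ij)
            (Star.kleisliStar component project detour))
          where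
          same-link : ∀ {k l} → Same (k , l) (i , j) → Same (link k l , link l k) (link i j , link j i)
          same-link straight = straight
          same-link crossed  = crossed

          project : ∀ {u v} → Adj (output ∖ (link i j , link j i)) u v →
                    Star (Adj (C ∖ (i , j))) (component u) (component v)
          project (inj₁ (k , e) , _) =
            let u∈ , v∈ = IsTreeOn.within (isTree k) e in subst (Star _ _) (≡-trans u∈ (≡-sym v∈)) ε
          project (inj₂ (k , l , kl , refl , refl) , ¬s) =
            subst₂ (Star _) (≡-sym (link-component kl)) (≡-sym (link-component (symm C kl)))
              ((kl , ¬s ∘ same-link) ◅ ε)

        -- A walk that leaves component i along the coarse edge i k can only come
        -- back along the same edge, hence to the point link i k it left from.
        forest-bridge : ∀ {i x y} → Adj (tree i) x y → ¬ Star (Adj (output ∖ (x , y))) y x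
        forest-bridge {i} {x} {y} xy detour = end (walk (inj₁ (y∈ , ε)) detour)
          where
          x∈ : component x ≡ i
          x∈ = proj₁ (IsTreeOn.within (isTree i) xy)

          y∈ : component y ≡ i
          y∈ = proj₂ (IsTreeOn.within (isTree i) xy)

          Reached : Fin n → Set
          Reached = Star (Adj (tree i ∖ (x , y))) y

          -- The invariant of the walk. While it is away from component `i`, it remembers the exit
          -- `link i k` and that the coarse edge `i k` has not been used since.
          Shadow : Fin n → Set
          Shadow z = component z ≡ i × Reached z
                   ⊎ (∃[ k ] Adj C i k × Star (Adj (C ∖ (i , k))) k (component z) × Reached (link i k))

          step : ∀ {u v} → Shadow u → Adj (output ∖ (x , y)) u v → Shadow v
          step (inj₁ (u∈ , r)) (inj₁ (j , e) , ¬s) with IsTreeOn.within (isTree j) e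
          ... | u∈′ , v∈′ with ≡-trans (≡-sym u∈′) u∈
          ...   | refl = inj₁ (v∈′ , r ◅◅ (e , ¬s) ◅ ε)
          step (inj₂ (k , ik , s , r)) (inj₁ (j , e) , _) =
            let u∈ , v∈ = IsTreeOn.within (isTree j) e
            in inj₂ (k , ik , subst (Star _ k) (≡-trans u∈ (≡-sym v∈)) s , r)
          step (inj₁ (u∈ , r)) (inj₂ (k , l , kl , refl , refl) , _) with ≡-trans (≡-sym (link-component kl)) u∈
          ... | refl = inj₂ (l , kl , subst (Star _ l) (≡-sym (link-component (symm C kl))) ε , r)
          step (inj₂ (k₀ , ik₀ , s , r)) (inj₂ (k , l , kl , refl , refl) , _) with same? (k , l) (i , k₀)
          -- To leave along the same edge again, the walk would have to be back in component `i`
          -- without having recrossed that edge.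
          ... | yes straight = ⊥-elim (coarse-bridges ik₀ (subst (Star _ k₀) (link-component kl) s))
          ... | yes crossed  = inj₁ (link-component (symm C kl) , r)
          ... | no ¬same     = inj₂ (k₀ , ik₀ , subst₂ (Star _) refl (≡-sym (link-component (symm C kl)))
            (subst (Star _ k₀) (link-component kl) s ◅◅ (kl , ¬same) ◅ ε) , r)

          walk : ∀ {u v} → Shadow u → Star (Adj (output ∖ (x , y))) u v → Shadow v
          walk sh ε       = sh
          walk sh (e ◅ s) = walk (step sh e) s

          end : ¬ Shadow x
          end (inj₁ (_ , r))          = tree-bridges i xy r
          end (inj₂ (k , ik , s , _)) = coarse-bridges ik (subst (Star _ k) x∈ s)

        output-spanning : IsSpanningTree output
        output-spanning = record
          { within    = λ _ → tt , tt
          ; connected = λ _ _ → output-connected _ _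
          ; acyclic   = bridges⇒acyclic λ where
              (inj₁ (_ , e))                      → forest-bridge e
              (inj₂ (_ , _ , ij , refl , refl)) → completion-bridge ij
          }

        -- Weights of the output and of the coarse tree

        output-weight : weight d output ≤ weight d forest + weight ŵ C
        output-weight = begin
          weight d output                                  ≤⟨ weight≤ω d d-sym d-nonNegative output cover
                                                                (All.universal (λ _ → nonNegative) _) ⟩
          ω d (edges forest ++ recorded (edges C))         ≈⟨ ω-++ d (edges forest) (recorded (edges C)) ⟩
          ω d (edges forest) + ω d (recorded (edges C))    ≈⟨ +-congˡ (ω-recorded (edges-adj C)) ⟩
          ω d (edges forest) + ω ŵ (edges C)               ≤⟨ +-mono-≤ (ω-edges≤weight d d-sym d-nonNegative forest)
                                                                       (ω-edges≤weight ŵ ŵ-sym ŵ-nonNegative C) ⟩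
          weight d forest + weight ŵ C                     ∎
          where
          recorded : List (Edge t) → List (Edge n)
          recorded = map λ (i , j) → link i j , link j i

          ω-recorded : ∀ {es} → All (uncurry (Adj C)) es → ω d (recorded es) ≈ ω ŵ es
          ω-recorded []         = ≈-refl
          ω-recorded (ij ∷ adj) = +-cong (link-attain (adj⇒≢ ij)) (ω-recorded adj)

          cover : ∀ {x y} → Adj output x y → Any (Same (x , y)) (edges forest ++ recorded (edges C))
          cover (inj₁ e)                           = Any.++⁺ˡ (edges-cover forest e)
          cover (inj₂ (i , j , ij , refl , refl)) = Any.++⁺ʳ (edges forest)
            (Any.map⁺ (Any.map (λ { straight → straight ; crossed → crossed }) (edges-cover C ij)))

        -- Shortcutting: a representative whose component is new is joined to the one attached last,
        -- `rep i`. The stretch walked since `rep i` is carried as the single distance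
        -- `d (rep i) x`, which the triangle inequality updates.
        follow : ∀ {c ks i} x ws → Grown c ks → i ∈ vertices c ks →
          ∃[ ks′ ] Grown c ks′ × ω ŵ ks′ ≤ ω ŵ ks + (d (rep i) x + walkLength x ws)
                   × (∀ {j} → j ∈ vertices c ks → j ∈ vertices c ks′)
                   × (∀ {j} → rep j ∈ ws → j ∈ vertices c ks′)
        follow {ks = ks} x [] g i∈ = ks , g
          , x≤x+y (+-nonNegative nonNegative ≤-refl) , (λ j∈ → j∈) , λ ()
        follow {c} {ks} {i} x (y ∷ ys) g i∈
          with (rep (component y) ≟ y) ×-dec ¬? (decMember _≟_ (component y) (vertices c ks))
        ... | yes (rep≡y , j∉) =
          let j = component y
              ks′ , g′ , ω≤ , keep , covers = follow y ys (grow i∈ j∉ g) (here refl)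
              i≢j = λ { refl → j∉ i∈ }
          in ks′ , g′
           , (begin
               ω ŵ ks′                                                 ≤⟨ ω≤ ⟩
               ŵ i j + ω ŵ ks + (d (rep j) y + walkLength y ys)        ≈⟨ +-congˡ (+-congʳ (≈⇒0 rep≡y)) ⟩
               ŵ i j + ω ŵ ks + (0# + walkLength y ys)                 ≈⟨ +-congˡ (+-identityˡ _) ⟩
               ŵ i j + ω ŵ ks + walkLength y ys
                 ≤⟨ +-monoˡ-≤ _ (+-monoˡ-≤ _ (ŵ≤toRep i≢j (rep-∈ i))) ⟩
               d (rep i) (rep j) + ω ŵ ks + walkLength y ys
                 ≡⟨ cong (λ z → d (rep i) z + ω ŵ ks + walkLength y ys) rep≡y ⟩
               d (rep i) y + ω ŵ ks + walkLength y ys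
                 ≤⟨ +-monoˡ-≤ _ (+-monoˡ-≤ _ (triangle (rep i) x y)) ⟩
               d (rep i) x + d x y + ω ŵ ks + walkLength y ys
                 ≈⟨ solve 4 (λ a b s l → a :+ b :+ s :+ l := s :+ (a :+ (b :+ l))) ≈-refl _ _ _ _ ⟩
               ω ŵ ks + (d (rep i) x + (d x y + walkLength y ys))      ∎)
           , keep ∘ there
           , λ { {j′} (here refl) → keep (here (≡-sym (rep-∈ j′))) ; (there rep∈) → covers rep∈ }
        ... | no ¬new =
          let ks′ , g′ , ω≤ , keep , covers = follow y ys g i∈
          in ks′ , g′
           , (begin
               ω ŵ ks′                                                 ≤⟨ ω≤ ⟩
               ω ŵ ks + (d (rep i) y + walkLength y ys)
                 ≤⟨ +-monoʳ-≤ _ (+-monoˡ-≤ _ (triangle (rep i) x y)) ⟩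
               ω ŵ ks + (d (rep i) x + d x y + walkLength y ys)        ≈⟨ +-congˡ (+-assoc _ _ _) ⟩
               ω ŵ ks + (d (rep i) x + (d x y + walkLength y ys))      ∎)
           , keep
           , λ { {j′} (here refl) → keep (old j′ ¬new) ; (there rep∈) → covers rep∈ }
          where
          -- A representative always passes the first half of the test, so if the test fails its
          -- component was attached before.
          old : ∀ j → ¬ (rep (component (rep j)) ≡ rep j × component (rep j) ∉ vertices c ks) → j ∈ vertices c ks
          old j ¬new with decMember _≟_ j (vertices c ks)
          ... | yes j∈ = j∈
          ... | no  j∉ = ⊥-elim (¬new (cong rep (rep-∈ j) , j∉ ∘ subst (_∈ vertices c ks) (rep-∈ j)))

        module _ {T : Graph n} (spanning : IsSpanningTree T) (c : Fin t) where

          private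
            connected : ∀ x y → Star (Adj T) x y
            connected _ _ = IsTreeOn.connected spanning tt tt

          coarse≤2* : weight ŵ C ≤ weight d T + weight d T
          coarse≤2* =
            let es , g , adj , spans = growAll (connected (rep c))
                ws , len≤ , toured = tour g
                ks , g′ , ω≤ , keep , covers = follow (rep c) ws [] (here refl)
                -- The list `ws` omits the start of the walk, so a representative equal to `rep c`
                -- is accounted for by the root.
                visited = λ j → case toured (spans (rep j)) of λ where
                  (here eq)    → keep (here (≡-trans (≡-sym (rep-∈ j)) (≡-trans (cong component eq) (rep-∈ c))))
                  (there rep∈) → covers rep∈
                es≤T = ω≤weight d d-sym d-nonNegative T adj (grown-distinct g)
            in begin
              weight ŵ C
                ≤⟨ MST≤ω ŵ ŵ-sym ŵ-nonNegative coarse-MST g′ visited ⟩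
              ω ŵ ks                                         ≤⟨ ω≤ ⟩
              0# + (d (rep c) (rep c) + walkLength (rep c) ws) ≈⟨ +-identityˡ _ ⟩
              d (rep c) (rep c) + walkLength (rep c) ws      ≈⟨ +-congʳ (≈⇒0 refl) ⟩
              0# + walkLength (rep c) ws                     ≈⟨ +-identityˡ _ ⟩
              walkLength (rep c) ws                          ≤⟨ len≤ ⟩
              ω d es + ω d es                                ≤⟨ +-mono-≤ es≤T es≤T ⟩
              weight d T + weight d T                        ∎

          private
            -- `T` with the components contracted. It is connected but may have cycles, since `T`
            -- need not connect a component internally; so a rooted tree is grown inside it.
            Quotient : Rel (Fin t) 0ℓ
            Quotient i j = i ≢ j × ∃[ x ] ∃[ y ] component x ≡ i × component y ≡ j × Adj T x y

            quotient-connected : ∀ i j → Star Quotient i j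
            quotient-connected i j = subst₂ (Star Quotient) (rep-∈ i) (rep-∈ j)
              (Star.kleisliStar component step (connected (rep i) (rep j)))
              where
              step : ∀ {x y} → Adj T x y → Star Quotient (component x) (component y)
              step {x} {y} xy with component x ≟ component y
              ... | yes eq = subst (Star Quotient _) eq ε
              ... | no neq = (neq , x , y , refl , refl , xy) ◅ ε

            -- Keeps track of the components touched so far, so that an edge ending in a new
            -- component differs from all edges already charged.
            Over : List (Fin t) → Edge n → Set
            Over is (x , y) = component x ∈ is × component y ∈ is

            Crossing : Edge n → Set
            Crossing (x , y) = Adj T x y × component x ≢ component y

            fresh : ∀ {v is e} → v ∉ is → component (proj₂ e) ≡ v → ∀ {es} → All (Over is) es → All (Distinct e) es
            fresh v∉ refl = All.map λ { (_ , y∈) straight → v∉ y∈ ; (x∈ , _) crossed → v∉ x∈ }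

            over-there : ∀ {v is es} → All (Over is) es → All (Over (v ∷ is)) es
            over-there = All.map λ (x∈ , y∈) → there x∈ , there y∈

            -- Growing along the walk from `x` to `y` skips revisited vertices, so each edge of the
            -- initial tree is charged at most once.
            treePath : ∀ {i x y} → component x ≡ i → component y ≡ i →
                       ∃[ es ] All (uncurry (Adj (tree i))) es × AllPairs Distinct es × d x y ≤ ω d es
            treePath {i} x∈ y∈ =
              let es , g , adj , _ , y∈′ = growTo {R = Adj (tree i)} [] [] (here refl)
                                         (IsTreeOn.connected (isTree i) x∈ y∈)
              in es , adj , grown-distinct g , d-rootˡ g y∈′

            -- The edge from p to v, realised in T by an edge x y, costs at most
            -- d x y + d y (rep v), and the second term is paid by the tree on v.
            charge : ∀ {ks} → Grown c ks → All (uncurry Quotient) ks →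
              ∃[ es ] ∃[ fs ] All Crossing es × AllPairs Distinct es × All (Over (vertices c ks)) es
                              × All (uncurry (Adj forest)) fs × AllPairs Distinct fs × All (Over (vertices c ks)) fs
                              × ω ŵ ks ≤ ω d es + ω d fs
            charge [] [] = [] , [] , [] , [] , [] , [] , [] , [] , ≥-reflexive (+-identityˡ 0#)
            charge (grow {p} {v} {ks} p∈ v∉ g) ((p≢v , x , y , refl , refl , xy) ∷ qs) =
              let es , fs , cross , dist , over , adj , dist′ , over′ , ω≤ = charge g qs
                  ps , ps-adj , ps-dist , d≤ = treePath refl (rep-∈ v)
                  ps∈ = All.map (IsTreeOn.within (isTree v)) ps-adj
              in (x , y) ∷ es , ps ++ fs
               , (xy , p≢v) ∷ cross
               -- The child `v` is new, so neither the crossing edge nor the path in the tree on `v`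
               -- meets what was charged before.
               , fresh v∉ refl over ∷ dist
               , (there p∈ , here refl) ∷ over-there over
               , All.++⁺ (All.map (v ,_) ps-adj) adj
               , AllPairs.++⁺ ps-dist dist′ (All.map (λ (_ , b∈) → fresh v∉ b∈ over′) ps∈)
               , All.++⁺ (All.map (λ (a∈ , b∈) → here a∈ , here b∈) ps∈) (over-there over′)
               , (begin
                   ŵ p v + ω ŵ ks                             ≤⟨ +-mono-≤ (ŵ≤toRep p≢v refl) ω≤ ⟩
                   d x (rep v) + (ω d es + ω d fs)            ≤⟨ +-monoˡ-≤ _ (triangle x y (rep v)) ⟩
                   d x y + d y (rep v) + (ω d es + ω d fs)    ≤⟨ +-monoˡ-≤ _ (+-monoʳ-≤ (d x y) d≤) ⟩
                   d x y + ω d ps + (ω d es + ω d fs)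
                     ≈⟨ solve 4 (λ a b e f → a :+ b :+ (e :+ f) := a :+ e :+ (b :+ f)) ≈-refl _ _ _ _ ⟩
                   d x y + ω d es + (ω d ps + ω d fs)         ≈⟨ +-congˡ (ω-++ d ps fs) ⟨
                   d x y + ω d es + ω d (ps ++ fs)            ∎)

          -- The charged crossing edges and the edges of `inner T` are disjoint sets of edges of
          -- `T`, and the charged paths lie in the forest. Having the inner weight on the left
          -- avoids a subtraction.
          coarse+inner≤ : weight ŵ C + weight d (inner T) ≤ weight d T + weight d forest
          coarse+inner≤ =
            let ks , g , qs , spans = growAll (quotient-connected c)
                es , fs , cross , dist , _ , adj , dist′ , _ , ω≤ = charge g qs
                is = edges (inner T)
            in begin
              weight ŵ C + weight d (inner T)
                ≤⟨ +-mono-≤ (≤-trans (MST≤ω ŵ ŵ-sym ŵ-nonNegative coarse-MST g spans) ω≤)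
                            (weight≤ω-edges d d-sym d-nonNegative (inner T)) ⟩
              ω d es + ω d fs + ω d is
                ≈⟨ solve 3 (λ e f i → e :+ f :+ i := e :+ i :+ f) ≈-refl _ _ _ ⟩
              ω d es + ω d is + ω d fs
                ≈⟨ +-congʳ (ω-++ d es is) ⟨
              ω d (es ++ is) + ω d fs
                ≤⟨ +-mono-≤
                     (ω≤weight d d-sym d-nonNegative T
                       (All.++⁺ (All.map proj₁ cross) (All.map proj₁ (edges-adj (inner T))))
                       (AllPairs.++⁺ dist (edges-distinct (inner T))
                         (All.map (λ (_ , x≢y) → All.map
                             (λ { (_ , eq) straight → x≢y eq ; (_ , eq) crossed → x≢y (≡-sym eq) })
                           (edges-adj (inner T))) cross)))
                     (ω≤weight d d-sym d-nonNegative forest adj dist′) ⟩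
              weight d T + weight d forest ∎

      inner≤ : ∀ T → weight d (inner T) ≤ weight d T
      inner≤ T = ≤-trans (weight≤ω-edges d d-sym d-nonNegative (inner T))
        (ω≤weight d d-sym d-nonNegative T (All.map proj₁ (edges-adj (inner T))) (edges-distinct (inner T)))

      -- The approximation ratio

      module _ {γ} (hasOverlap : HasOverlap X F γ) where

        private
          m : Carrier
          m = proj₁ hasOverlap

          T* : Graph n
          T* = proj₁ (proj₁ (proj₁ (proj₂ hasOverlap)))

          T*-MST : IsMST d T*
          T*-MST = proj₁ (proj₂ (proj₁ (proj₁ (proj₂ hasOverlap))))

          inner≈m : weight d (inner T*) ≈ m
          inner≈m = proj₂ (proj₂ (proj₁ (proj₁ (proj₂ hasOverlap))))

          m≉0 : m ≉ 0#
          m≉0 = proj₁ (proj₂ (proj₂ hasOverlap))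

          γ≈W/m : γ ≈ weight d forest / m
          γ≈W/m = proj₂ (proj₂ (proj₂ hasOverlap))

          0≤m : 0# ≤ m
          0≤m = ≤-trans (weight-nonNegative d d-sym d-nonNegative (inner T*)) (≤-reflexive inner≈m)

        overlap-component : Fin t
        overlap-component = component (point d (inner T*) (m≉0 ∘ ≈-trans (≈-sym inner≈m)))

        overlap-nonNegative : 0# ≤ γ
        overlap-nonNegative = ≤-trans
          (*-nonNegative (weight-nonNegative d d-sym d-nonNegative forest) (⁻¹-nonNegative 0≤m m≉0))
          (≥-reflexive γ≈W/m)

        -- The estimates are applied to `T*`, the minimum spanning tree attaining the maximum `m`
        -- that defines `γ`. Minimality of `T*` and nonnegativity of `β γ` then transfer the bound
        -- to `T`.
        output≤β* : ∀ (R : Run X F) {T} → IsSpanningTree T → weight d (Run.output R) ≤ β γ * weight d T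
        output≤β* R {T} spanning = begin
          weight d (Run.output R)
            ≤⟨ output-weight R ⟩
          weight d forest + weight (Run.ŵ R) (Run.coarseTree R)
            ≤⟨ ≤β* overlap-nonNegative 0≤m m≤τ W≈γm
                 (≤-trans (+-monoʳ-≤ _ (≥-reflexive inner≈m)) (coarse+inner≤ R (proj₁ T*-MST) overlap-component))
                 (coarse≤2* R (proj₁ T*-MST) overlap-component) ⟩
          β γ * weight d T*
            ≤⟨ *-monoʳ-≤ (β-nonNegative overlap-nonNegative) (proj₂ T*-MST T spanning) ⟩
          β γ * weight d T ∎
          where
          m≤τ : m ≤ weight d T*
          m≤τ = ≤-trans (≥-reflexive inner≈m) (inner≤ T*)

          W≈γm : weight d forest ≈ γ * m
          W≈γm = ≈-sym (≈-trans (*-congʳ γ≈W/m) (x/y*y≈x (weight d forest) m≉0))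

theorem4p3 : ∀ {c ℓ₁ ℓ₂} (K : EuclideanField c ℓ₁ ℓ₂) →
    let open EuclideanField K
        open Approximation K
    in ∀ (n t : ℕ) (X : FiniteMetricSpace n) (F : InitialForest n t) (γ : Carrier) →
       let open FiniteMetricSpace X in
       HasOverlap X F γ →
       Run X F
       × (∀ (R : Run X F) →
            let T̂ = Run.output R in
            IsSpanningTree T̂
            × (∀ T → IsMST d T →
                 weight d T ≤ weight d T̂ × weight d T̂ ≤ β γ * weight d T))
       × β γ ≤ 2# * γ + 1#
theorem4p3 K n t X F γ hasOverlap =
  initialRun K X F (overlap-component K X F hasOverlap)
  , (λ R → output-spanning K X F R , λ T (spanning , minimal) →
      minimal _ (output-spanning K X F R) , output≤β* K X F hasOverlap R spanning)
  , β≤2γ+1 K (overlap-nonNegative K X F hasOverlap)
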